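{- Let $n$ be a positive integer and let $\Omega$ be an $n$-element set. For all positive integers $a$ and $k$, every centred family of $a$ subsets of $\Omega$ contains the smallest number of chains of length $k$ among all families of $a$ subsets of $\Omega$. Moreover, if $k \ge 2$ and a centred family of $a$ subsets of $\Omega$ contains at least one chain of length $k$, then every non-centred family of $a$ subsets of $\Omega$ contains strictly more chains of length $k$.
   Context: A chain of length $k$ in a family $\mathcal{A}$ of sets is a collection of $k$ sets $A_1 \subset A_2 \subset \dotsb \subset A_k$ (proper inclusions) all belonging to $\mathcal{A}$. A family $\mathcal{A}$ of subsets of an $n$-element set $\Omega$ is called centred if: (i) whenever $A \in \mathcal{A}$ and $B \subseteq \Omega$ satisfy $\big||B| - n/2\big| < \big||A| - n/2\big|$, we have $B \in \mathcal{A}$; and (ii) whenever for some $i < n/2$ the family $\mathcal{A}$ contains some but not all subsets of $\Omega$ of size $i$ and some but not all subsets of $\Omega$ of size $n-i$, then either there are no $A, B \in \mathcal{A}$ with $|A| = i$, $|B| = n-i$ and $A \subset B$, or there are no $A, B \notin \mathcal{A}$ (subsets of $\Omega$) with $|A| = i$, $|B| = n-i$ and $A \subset B$. -}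

module Defs where

open import Data.Bool using (Bool; true; false; _∧_)
open import Data.Nat using (ℕ; zero; suc; _+_; _*_; _∸_; _<_; ∣_-_∣)
open import Data.Fin.Subset using (Subset; outside; inside; _⊂_; ∣_∣)
open import Data.Fin.Subset.Properties using (_⊂?_)
open import Data.List using (List; []; _∷_; map; concatMap; filterᵇ; length)
open import Data.Vec using (Vec; []; _∷_)
open import Data.Product using (Σ; ∃; _×_; _,_)
open import Data.Sum using (_⊎_)
open import Relation.Nullary using (¬_; does)
open import Relation.Binary.PropositionalEquality using (_≡_)

Family : ℕ → Set
Family n = Subset n → Bool

_∈F_ : ∀ {n} → Subset n → Family n → Set
A ∈F 𝒜 = 𝒜 A ≡ true

_∉F_ : ∀ {n} → Subset n → Family n → Set
A ∉F 𝒜 = ¬ (A ∈F 𝒜)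

allSubsets : (n : ℕ) → List (Subset n)
allSubsets zero = [] ∷ []
allSubsets (suc n) = concatMap (λ s → (outside ∷ s) ∷ (inside ∷ s) ∷ []) (allSubsets n)

size : ∀ {n} → Family n → ℕ
size {n} 𝒜 = length (filterᵇ 𝒜 (allSubsets n))

allTuples : (n k : ℕ) → List (Vec (Subset n) k)
allTuples n zero = [] ∷ []
allTuples n (suc k) = concatMap (λ A → map (A ∷_) (allTuples n k)) (allSubsets n)

isChain : ∀ {n k} → Family n → Vec (Subset n) k → Bool
isChain 𝒜 [] = true
isChain 𝒜 (A ∷ []) = 𝒜 A
isChain 𝒜 (A ∷ B ∷ As) = 𝒜 A ∧ does (A ⊂? B) ∧ isChain 𝒜 (B ∷ As)

chains : ∀ {n} → ℕ → Family n → ℕ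
chains {n} k 𝒜 = length (filterᵇ (isChain 𝒜) (allTuples n k))

-- ||B| - n/2| < ||A| - n/2|, multiplied through by 2
closerToMiddle : ∀ {n} → Subset n → Subset n → Set
closerToMiddle {n} B A = ∣ 2 * ∣ B ∣ - n ∣ < ∣ 2 * ∣ A ∣ - n ∣

someButNotAll : ∀ {n} → Family n → ℕ → Set
someButNotAll {n} 𝒜 i =
  (∃ λ (A : Subset n) → ∣ A ∣ ≡ i × A ∈F 𝒜) × (∃ λ (A : Subset n) → ∣ A ∣ ≡ i × A ∉F 𝒜)

record Centred {n : ℕ} (𝒜 : Family n) : Set where
  field
    cond-i : ∀ (A B : Subset n) → A ∈F 𝒜 → closerToMiddle B A → B ∈F 𝒜
    cond-ii : ∀ (i : ℕ) → 2 * i < n →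
      someButNotAll 𝒜 i → someButNotAll 𝒜 (n ∸ i) →
      (¬ (∃ λ (A : Subset n) → ∃ λ (B : Subset n) →
            ∣ A ∣ ≡ i × ∣ B ∣ ≡ n ∸ i × A ∈F 𝒜 × B ∈F 𝒜 × A ⊂ B))
      ⊎
      (¬ (∃ λ (A : Subset n) → ∃ λ (B : Subset n) →
            ∣ A ∣ ≡ i × ∣ B ∣ ≡ n ∸ i × A ∉F 𝒜 × B ∉F 𝒜 × A ⊂ B))

{-# OPTIONS --safe #-}
module Submission where

-- A uniformly random maximal chain of the Boolean lattice meets a family in a random pattern X of levels.
-- A chain of r + 1 sets with level set S lies on a random maximal chain with probability 1 / N_S, where N_S
-- is the number of all chains with level set S, so the number of chains in the family is the expected
-- number of chains in the union of the levels of X. Hence it is enough to minimise, for a suitable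
-- multiplier D, the Lagrangian (number of chains) + D (number of missing sets) over unions of levels.
-- There, if M is the level of X farthest from the middle and l is the missing level next to M and closer
-- to the middle, then replacing M by l, or deleting M, lowers the cost; this leaves only intervals of
-- levels around the middle, whose costs are compared one level at a time. With D the marginal number of
-- chains at the outermost levels of a centred family, the minimisers are exactly the patterns of centred
-- families: the two values of D correspond to the two alternatives of condition (ii).

open import Defs
open import Data.Bool using (Bool; true; false; not; _∧_)
import Data.Bool.Properties as Bool
open import Data.Bool.Properties using (¬-not)
open import Data.Empty using (⊥-elim)
import Data.Fin as Fin
open import Data.Fin.Subset using (Subset; outside; inside; _⊆_; _⊂_; ∣_∣; ⊥)
open import Data.Fin.Subset.Properties using (_⊂?_; _∈?_; out⊆; s⊆s; drop-∷-⊆; ⊆-refl; p⊆q⇒∣p∣≤∣q∣; p⊂q⇒p⊆q; p⊂q⇒∣p∣<∣q∣; ⊆-min; anySubset?; ∣p∣≤n)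
open import Data.List using (List; []; _∷_; map; concatMap; filterᵇ; length; _++_)
open import Data.Nat
open import Data.Nat.Induction using (<-wellFounded)
open import Data.Nat.Properties
open import Data.Nat.Tactic.RingSolver using (solve-∀)
open import Data.Product using (∃; ∃₂; _×_; _,_; proj₁; proj₂)
open import Data.Sum using (_⊎_; inj₁; inj₂; [_,_]′)
open import Data.Vec as Vec using (Vec; []; _∷_; here)
open import Induction.WellFounded using (Acc; acc)
open import Relation.Binary.Definitions using (tri<; tri≈; tri>)
open import Relation.Binary.PropositionalEquality
open import Relation.Nullary using (¬_; Dec; yes; no; contradiction; does)
open import Relation.Nullary.Decidable using (dec-true; dec-false; _×-dec_)

-- Antidiagonal sums and binomial coefficients

-- Families of equal size miss equally many sets, so the penalty term leaves their comparison
-- unchanged; it turns the size constraint into a price paid on each maximal chain separately. The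
-- bound is sharp only if one and the same D makes every pattern of the centred family a minimiser,
-- although levels `e` and `m` may be partly filled, so that different maximal chains see different
-- patterns. Hence D must make a change at the outermost level free: it has to equal the number of
-- chains that one more set there creates. That number depends on whether level `e` is present below
-- level `m`, whence two values: with one, the patterns containing at most one of the two levels
-- tie; with the other, those containing at least one. Equality of the totals forces a minimiser on
-- every single maximal chain, and each comparable pair of sets lies on one of them, which recovers
-- centredness. The obstacle to strictness is the empty set: its level has one member whatever the
-- ground set, so counts need not grow there, and sums may vanish altogether. Sums run over
-- `a + b ≡ n`, so that each level comes with its co-level.

antidiag : ℕ → (ℕ → ℕ → ℕ) → ℕ
antidiag zero    f = f 0 0
antidiag (suc n) f = f 0 (suc n) + antidiag n (λ a b → f (suc a) b)

antidiag-cong : ∀ n {f g} → (∀ a b → a + b ≡ n → f a b ≡ g a b) → antidiag n f ≡ antidiag n g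
antidiag-cong zero    h = h 0 0 refl
antidiag-cong (suc n) h =
  cong₂ _+_ (h 0 (suc n) refl) (antidiag-cong n (λ a b eq → h (suc a) b (cong suc eq)))

antidiag-mono : ∀ n {f g} → (∀ a b → a + b ≡ n → f a b ≤ g a b) → antidiag n f ≤ antidiag n g
antidiag-mono zero    h = h 0 0 refl
antidiag-mono (suc n) h =
  +-mono-≤ (h 0 (suc n) refl) (antidiag-mono n (λ a b eq → h (suc a) b (cong suc eq)))

antidiag-strict : ∀ n {f g} → (∀ a b → a + b ≡ n → f a b ≤ g a b) →
  ∀ a b → a + b ≡ n → f a b < g a b → antidiag n f < antidiag n g
antidiag-strict zero    h zero    zero refl lt = lt
antidiag-strict (suc n) h zero    b refl lt =
  +-mono-<-≤ lt (antidiag-mono n (λ a b eq → h (suc a) b (cong suc eq)))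
antidiag-strict (suc n) h (suc a) b eq lt =
  +-mono-≤-< (h 0 (suc n) refl)
    (antidiag-strict n (λ a b eq → h (suc a) b (cong suc eq)) a b (suc-injective eq) lt)

antidiag-zero : ∀ n → antidiag n (λ _ _ → 0) ≡ 0
antidiag-zero zero    = refl
antidiag-zero (suc n) = antidiag-zero n

antidiag-term : ∀ n f a b → a + b ≡ n → f a b ≤ antidiag n f
antidiag-term zero    f zero    zero refl = ≤-refl
antidiag-term (suc n) f zero    b refl = m≤m+n _ _
antidiag-term (suc n) f (suc a) b eq =
  ≤-trans (antidiag-term n (λ a b → f (suc a) b) a b (suc-injective eq)) (m≤n+m _ (f 0 (suc n)))

antidiag-positive : ∀ n f → 0 < antidiag n f → ∃₂ λ a b → a + b ≡ n × 0 < f a b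
antidiag-positive zero f p = 0 , 0 , refl , p
antidiag-positive (suc n) f p with f 0 (suc n) in eq
... | suc _ = 0 , suc n , refl , subst (0 <_) (sym eq) z<s
... | zero with antidiag-positive n (λ a b → f (suc a) b) p
...   | a , b , e , q = suc a , b , cong suc e , q

+-interchange : ∀ a b c d → (a + b) + (c + d) ≡ (a + c) + (b + d)
+-interchange = solve-∀

antidiag-+ : ∀ n f g → antidiag n (λ a b → f a b + g a b) ≡ antidiag n f + antidiag n g
antidiag-+ zero    f g = refl
antidiag-+ (suc n) f g
  rewrite antidiag-+ n (λ a b → f (suc a) b) (λ a b → g (suc a) b) =
  +-interchange (f 0 (suc n)) (g 0 (suc n)) _ _

antidiag-*ˡ : ∀ n c f → antidiag n (λ a b → c * f a b) ≡ c * antidiag n f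
antidiag-*ˡ zero    c f = refl
antidiag-*ˡ (suc n) c f
  rewrite antidiag-*ˡ n c (λ a b → f (suc a) b) = sym (*-distribˡ-+ c _ _)

antidiag-*ʳ : ∀ n c f → antidiag n (λ a b → f a b * c) ≡ antidiag n f * c
antidiag-*ʳ n c f = begin
  antidiag n (λ a b → f a b * c) ≡⟨ antidiag-cong n (λ a b _ → *-comm (f a b) c) ⟩
  antidiag n (λ a b → c * f a b) ≡⟨ antidiag-*ˡ n c f ⟩
  c * antidiag n f               ≡⟨ *-comm c _ ⟩
  antidiag n f * c               ∎
  where open ≡-Reasoning

antidiag-last : ∀ n f → antidiag (suc n) f ≡ antidiag n (λ a b → f a (suc b)) + f (suc n) 0
antidiag-last zero    f = refl
antidiag-last (suc n) f
  rewrite antidiag-last n (λ a b → f (suc a) b) = sym (+-assoc (f 0 (2 + n)) _ _)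

antidiag-flip : ∀ n f → antidiag n f ≡ antidiag n (λ a b → f b a)
antidiag-flip zero    f = refl
antidiag-flip (suc n) f = begin
  f 0 (suc n) + antidiag n (λ a b → f (suc a) b) ≡⟨ +-comm (f 0 (suc n)) _ ⟩
  antidiag n (λ a b → f (suc a) b) + f 0 (suc n)
    ≡⟨ cong (_+ f 0 (suc n)) (antidiag-flip n (λ a b → f (suc a) b)) ⟩
  antidiag n (λ a b → f (suc b) a) + f 0 (suc n) ≡⟨ antidiag-last n (λ a b → f b a) ⟨
  antidiag (suc n) (λ a b → f b a) ∎
  where open ≡-Reasoning

-- Both sides are the sum over all `a + c + d ≡ n`, grouped by `a + c` or by `c + d`.
antidiag-assoc : ∀ n (g : ℕ → ℕ → ℕ → ℕ) →
  antidiag n (λ e d → antidiag e (λ a c → g a c d)) ≡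
  antidiag n (λ a b → antidiag b (λ c d → g a c d))
antidiag-assoc zero    g = refl
antidiag-assoc (suc n) g = begin
  g 0 0 (suc n) + antidiag n (λ e d → g 0 (suc e) d + antidiag e (λ a c → g (suc a) c d))
    ≡⟨ cong (g 0 0 (suc n) +_) (antidiag-+ n (λ e d → g 0 (suc e) d) _) ⟩
  g 0 0 (suc n) + (antidiag n (λ e d → g 0 (suc e) d) +
                   antidiag n (λ e d → antidiag e (λ a c → g (suc a) c d)))
    ≡⟨ cong (λ t → g 0 0 (suc n) + (antidiag n (λ e d → g 0 (suc e) d) + t))
         (antidiag-assoc n (λ a → g (suc a))) ⟩
  g 0 0 (suc n) + (antidiag n (λ e d → g 0 (suc e) d) +
                   antidiag n (λ a b → antidiag b (λ c d → g (suc a) c d)))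
    ≡⟨ +-assoc (g 0 0 (suc n)) _ _ ⟨
  antidiag (suc n) (λ c d → g 0 c d) + antidiag n (λ a b → antidiag b (λ c d → g (suc a) c d)) ∎
  where open ≡-Reasoning

infix 4 _⊏_
-- Strictness except at zero. Unlike `<`, this passes through sums and products whose terms may
-- vanish, so it can be proved termwise; positivity of D later turns it into a strict inequality.
_⊏_ : ℕ → ℕ → Set
m ⊏ n = m ≡ 0 ⊎ m < n

⊏⇒≤ : ∀ {m n} → m ⊏ n → m ≤ n
⊏⇒≤ (inj₁ refl) = z≤n
⊏⇒≤ (inj₂ lt)   = <⇒≤ lt

⊏-≤-trans : ∀ {m n o} → m ⊏ n → n ≤ o → m ⊏ o
⊏-≤-trans (inj₁ eq) _  = inj₁ eq
⊏-≤-trans (inj₂ lt) le = inj₂ (<-≤-trans lt le)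

≤-⊏-trans : ∀ {m n o} → m ≤ n → n ⊏ o → m ⊏ o
≤-⊏-trans le (inj₁ refl) = inj₁ (n≤0⇒n≡0 le)
≤-⊏-trans le (inj₂ lt)   = inj₂ (≤-<-trans le lt)

⊏-+ : ∀ {m n o p} → m ⊏ n → o ⊏ p → m + o ⊏ n + p
⊏-+ (inj₁ refl) (inj₁ refl) = inj₁ refl
⊏-+ {n = n} (inj₁ refl) (inj₂ lt) = inj₂ (<-≤-trans lt (m≤n+m _ n))
⊏-+ (inj₂ lt)   op          = inj₂ (+-mono-<-≤ lt (⊏⇒≤ op))

⊏-*-≤ : ∀ {m n o p} → m ⊏ n → o ≤ p → m * o ⊏ n * p
⊏-*-≤ (inj₁ refl) _ = inj₁ refl
⊏-*-≤ {m} {o = zero} (inj₂ _) _ = inj₁ (*-zeroʳ m)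
⊏-*-≤ {m} {n} {o = suc o} (inj₂ lt) le =
  inj₂ (<-≤-trans (*-monoˡ-< (suc o) lt) (*-monoʳ-≤ n le))

≤-*-⊏ : ∀ {m n o p} → m ≤ n → o ⊏ p → m * o ⊏ n * p
≤-*-⊏ {m} {n} {o} {p} le op rewrite *-comm m o | *-comm n p = ⊏-*-≤ op le

antidiag-⊏ : ∀ n {f g} → (∀ a b → a + b ≡ n → f a b ⊏ g a b) → antidiag n f ⊏ antidiag n g
antidiag-⊏ zero    h = h 0 0 refl
antidiag-⊏ (suc n) h =
  ⊏-+ (h 0 (suc n) refl) (antidiag-⊏ n (λ a b eq → h (suc a) b (cong suc eq)))

-- binom a b is the binomial coefficient C(a + b, a); this indexing avoids truncated subtraction.
binom : ℕ → ℕ → ℕ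
binom zero    b       = 1
binom (suc a) zero    = 1
binom (suc a) (suc b) = binom a (suc b) + binom (suc a) b

binom-zeroʳ : ∀ a → binom a 0 ≡ 1
binom-zeroʳ zero    = refl
binom-zeroʳ (suc a) = refl

binom-comm : ∀ a b → binom a b ≡ binom b a
binom-comm zero    b       = sym (binom-zeroʳ b)
binom-comm (suc a) zero    = refl
binom-comm (suc a) (suc b) = begin
  binom a (suc b) + binom (suc a) b ≡⟨ +-comm (binom a (suc b)) _ ⟩
  binom (suc a) b + binom a (suc b) ≡⟨ cong₂ _+_ (binom-comm (suc a) b) (binom-comm a (suc b)) ⟩
  binom b (suc a) + binom (suc b) a ∎
  where open ≡-Reasoning

binom-positive : ∀ a b → 0 < binom a b
binom-positive zero    b       = z<s
binom-positive (suc a) zero    = z<s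
binom-positive (suc a) (suc b) = <-≤-trans (binom-positive a (suc b)) (m≤m+n _ _)

binom-mono-step : ∀ a b → binom a b ≤ binom (suc a) b
binom-mono-step a zero    rewrite binom-zeroʳ a = ≤-refl
binom-mono-step a (suc b) = m≤m+n _ _

binom-monoˡ : ∀ {a a′} b → a ≤ a′ → binom a b ≤ binom a′ b
binom-monoˡ b le = go (≤⇒≤′ le)
  where
  go : ∀ {a a′} → a ≤′ a′ → binom a b ≤ binom a′ b
  go (≤′-reflexive refl) = ≤-refl
  go (≤′-step p)         = ≤-trans (go p) (binom-mono-step _ b)

binom-monoʳ : ∀ a {b b′} → b ≤ b′ → binom a b ≤ binom a b′
binom-monoʳ a {b} {b′} le rewrite binom-comm a b | binom-comm a b′ = binom-monoˡ a le

binom-strictˡ : ∀ {a a′} b → a < a′ → binom a (suc b) < binom a′ (suc b)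
binom-strictˡ {a} b lt =
  <-≤-trans (m<m+n (binom a (suc b)) (binom-positive (suc a) b)) (binom-monoˡ (suc b) lt)

binom-strictʳ : ∀ a {b b′} → b < b′ → binom (suc a) b < binom (suc a) b′
binom-strictʳ a {b} {b′} lt rewrite binom-comm (suc a) b | binom-comm (suc a) b′ =
  binom-strictˡ a lt

binom-! : ∀ a b → binom a b * (a ! * b !) ≡ (a + b) !
binom-! zero    b    = trans (+-identityʳ _) (+-identityʳ _)
binom-! (suc a) zero rewrite +-identityʳ a = trans (+-identityʳ _) (*-identityʳ _)
binom-! (suc a) (suc b) = begin
  (binom a (suc b) + binom (suc a) b) * ((suc a * a !) * (suc b * b !))
    ≡⟨ lemma (binom a (suc b)) (binom (suc a) b) (suc a) (a !) (suc b) (b !) ⟩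
  suc a * (binom a (suc b) * (a ! * (suc b) !)) + suc b * (binom (suc a) b * ((suc a) ! * b !))
    ≡⟨ cong₂ (λ s t → suc a * s + suc b * t) (binom-! a (suc b)) (binom-! (suc a) b) ⟩
  suc a * (a + suc b) ! + suc b * (suc a + b) !
    ≡⟨ cong (λ s → suc a * s ! + suc b * (suc a + b) !) (+-suc a b) ⟩
  suc a * (suc a + b) ! + suc b * (suc a + b) !
    ≡⟨ *-distribʳ-+ ((suc a + b) !) (suc a) (suc b) ⟨
  (suc a + suc b) * (suc a + b) !
    ≡⟨ cong (λ s → (suc a + suc b) * s !) (sym (+-suc a b)) ⟩
  (suc a + suc b) ! ∎
  where
  open ≡-Reasoning
  lemma : ∀ p q s x t y → (p + q) * ((s * x) * (t * y)) ≡ s * (p * (x * (t * y))) + t * (q * ((s * x) * y))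
  lemma = solve-∀

-- Both products are the trinomial coefficient: multiplied by `a ! * (c ! * d !)` each becomes the
-- factorial of `a + c + d`.
binom-trinomial : ∀ a c d → binom (a + c) d * binom a c ≡ binom a (c + d) * binom c d
binom-trinomial a c d = *-cancelʳ-≡ _ _ (a ! * (c ! * d !))
  {{m*n≢0 (a !) _ {{a !≢0}} {{c !* d !≢0}}}} (begin
  binom (a + c) d * binom a c * (a ! * (c ! * d !)) ≡⟨ l₁ (binom (a + c) d) (binom a c) (a !) (c !) (d !) ⟩
  binom (a + c) d * ((binom a c * (a ! * c !)) * d !) ≡⟨ cong (λ s → binom (a + c) d * (s * d !)) (binom-! a c) ⟩
  binom (a + c) d * ((a + c) ! * d !) ≡⟨ binom-! (a + c) d ⟩
  (a + c + d) ! ≡⟨ cong _! (+-assoc a c d) ⟩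
  (a + (c + d)) ! ≡⟨ binom-! a (c + d) ⟨
  binom a (c + d) * (a ! * (c + d) !) ≡⟨ cong (λ s → binom a (c + d) * (a ! * s)) (binom-! c d) ⟨
  binom a (c + d) * (a ! * (binom c d * (c ! * d !))) ≡⟨ l₂ (binom a (c + d)) (binom c d) (a !) (c ! * d !) ⟩
  binom a (c + d) * binom c d * (a ! * (c ! * d !)) ∎)
  where
  open ≡-Reasoning
  l₁ : ∀ p q x y z → p * q * (x * (y * z)) ≡ p * ((q * (x * y)) * z)
  l₁ = solve-∀
  l₂ : ∀ p q x y → p * (x * (q * y)) ≡ p * q * (x * y)
  l₂ = solve-∀

binom-absorb : ∀ a b → binom (suc a) b * suc a ≡ binom a (suc b) * suc b
binom-absorb a b = *-cancelʳ-≡ _ _ (a ! * b !) {{a !* b !≢0}} (begin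
  binom (suc a) b * suc a * (a ! * b !) ≡⟨ l₁ (binom (suc a) b) (suc a) (a !) (b !) ⟩
  binom (suc a) b * ((suc a) ! * b !) ≡⟨ binom-! (suc a) b ⟩
  (suc a + b) ! ≡⟨ cong _! (+-suc a b) ⟨
  (a + suc b) ! ≡⟨ binom-! a (suc b) ⟨
  binom a (suc b) * (a ! * (suc b) !) ≡⟨ l₂ (binom a (suc b)) (suc b) (a !) (b !) ⟩
  binom a (suc b) * suc b * (a ! * b !) ∎)
  where
  open ≡-Reasoning
  l₁ : ∀ p s x y → p * s * (x * y) ≡ p * ((s * x) * y)
  l₁ = solve-∀
  l₂ : ∀ p s x y → p * (x * (s * y)) ≡ p * s * (x * y)
  l₂ = solve-∀

binom-decreasing-step : ∀ a b → b < a → binom (suc a) b < binom a (suc b)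
binom-decreasing-step a b b<a = *-cancelʳ-< (suc b) _ _ (begin-strict
  binom (suc a) b * suc b <⟨ *-monoʳ-< (binom (suc a) b) {{>-nonZero (binom-positive (suc a) b)}} (s<s b<a) ⟩
  binom (suc a) b * suc a ≡⟨ binom-absorb a b ⟩
  binom a (suc b) * suc b ∎)
  where open ≤-Reasoning

binom-decreasing : ∀ a t e → e + suc t ≤ a → binom (a + suc t) e < binom a (e + suc t)
binom-decreasing a zero e le
  rewrite +-comm a 1 | +-comm e 1 = binom-decreasing-step a e le
binom-decreasing a (suc t) e le = begin-strict
  binom (a + suc (suc t)) e   ≡⟨ cong (λ s → binom s e) (+-suc a (suc t)) ⟩
  binom (suc (a + suc t)) e   <⟨ binom-decreasing-step (a + suc t) e (≤-trans (m≤m+n (suc e) (suc t)) (≤-trans (≤-reflexive (sym (+-suc e (suc t)))) (≤-trans le (m≤m+n a _)))) ⟩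
  binom (a + suc t) (suc e)   <⟨ binom-decreasing a t (suc e) (≤-trans (≤-reflexive (sym (+-suc e (suc t)))) le) ⟩
  binom a (suc e + suc t)     ≡⟨ cong (binom a) (+-suc e (suc t)) ⟨
  binom a (e + suc (suc t))   ∎
  where open ≤-Reasoning

+-suc-shuffle : ∀ l E t → l + suc (E + t) ≡ l + suc t + E
+-suc-shuffle = solve-∀

binom-unimodal′ : ∀ {l b M E} → b ≤ l → l + b ≡ M + E → E < b → binom M E < binom l b
binom-unimodal′ {l} {b} {M} {E} b≤l eq E<b
  with t , refl ← m≤n⇒∃[o]m+o≡n E<b
  with refl ← +-cancelʳ-≡ E M (l + suc t) (trans (sym eq) (+-suc-shuffle l E t)) =
  subst (λ s → binom (l + suc t) E < binom l s) (+-suc E t)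
    (binom-decreasing l t E (subst (_≤ l) (sym (+-suc E t)) b≤l))

-- The hypotheses place `l` strictly between `E` and `M`. By symmetry `b ≤ l` may be assumed; then
-- each step from `M` down to `l` stays above the middle, where binomials increase towards it.
binom-unimodal : ∀ {l b M E} → l + b ≡ M + E → E < l → E < b → binom M E < binom l b
binom-unimodal {l} {b} eq E<l E<b with ≤-total b l
... | inj₁ b≤l = binom-unimodal′ b≤l eq E<b
... | inj₂ l≤b rewrite binom-comm l b = binom-unimodal′ l≤b (trans (+-comm b l) eq) E<l

-- Counting chains in weighted levels

antidiag-swap : ∀ m n (f : ℕ → ℕ → ℕ → ℕ → ℕ) →
  antidiag m (λ a b → antidiag n (λ c d → f a b c d)) ≡
  antidiag n (λ c d → antidiag m (λ a b → f a b c d))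
antidiag-swap zero    n f = refl
antidiag-swap (suc m) n f = begin
  antidiag n (f 0 (suc m)) + antidiag m (λ a b → antidiag n (f (suc a) b))
    ≡⟨ cong (antidiag n (f 0 (suc m)) +_) (antidiag-swap m n (λ a → f (suc a))) ⟩
  antidiag n (f 0 (suc m)) + antidiag n (λ c d → antidiag m (λ a b → f (suc a) b c d))
    ≡⟨ antidiag-+ n (f 0 (suc m)) _ ⟨
  antidiag n (λ c d → antidiag (suc m) (λ a b → f a b c d)) ∎
  where open ≡-Reasoning

antidiag-single : ∀ n f l b → l + b ≡ n → (∀ a c → a + c ≡ n → a ≢ l → f a c ≡ 0) →
  antidiag n f ≡ f l b
antidiag-single n f zero b refl h with n
... | zero = refl
... | suc m = trans (cong (f 0 (suc m) +_)
    (trans (antidiag-cong m (λ a c e → h (suc a) c (cong suc e) (λ ()))) (antidiag-zero m)))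
  (+-identityʳ _)
antidiag-single (suc n) f (suc l) b eq h
  rewrite h 0 (suc n) refl (λ ()) =
  antidiag-single n (λ a c → f (suc a) c) l b (suc-injective eq)
    (λ a c e a≢l → h (suc a) c (cong suc e) (λ e′ → a≢l (suc-injective e′)))

-- As a factor in a sum over `a + g ≡ m` it excludes `a ≡ m`, which makes inclusions proper.
positive : ℕ → ℕ
positive zero    = 0
positive (suc _) = 1

-- The factor `positive g` removes the term at `l` from the first sum, since the second one starts
-- with it.
antidiag-split : ∀ l u f →
  antidiag (l + u) f ≡
  antidiag l (λ a g → positive g * f a (g + u)) + antidiag u (λ a g → f (l + a) g)
antidiag-split zero    u f = refl
antidiag-split (suc l) u f
  rewrite antidiag-split l u (λ a b → f (suc a) b) | +-identityʳ (f 0 (suc l + u)) =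
  sym (+-assoc (f 0 (suc l + u)) _ _)

-- Weighted number of chains of r proper subsets of an m-set, where a set of size a has weight x a.
below : (ℕ → ℕ) → ℕ → ℕ → ℕ
below x zero    m = 1
below x (suc r) m = antidiag m (λ a g → positive g * (x a * (binom a g * below x r a)))

below-mono-weight : ∀ {x x′} r m → (∀ a → a < m → x a ≤ x′ a) → below x r m ≤ below x′ r m
below-mono-weight zero    m h = ≤-refl
below-mono-weight {x} {x′} (suc r) m h = antidiag-mono m term
  where
  term : ∀ a g → a + g ≡ m → positive g * (x a * (binom a g * below x r a)) ≤
                             positive g * (x′ a * (binom a g * below x′ r a))
  term a zero    eq = z≤n
  term a (suc g) eq = *-monoʳ-≤ 1 (*-mono-≤ (h a a<m)
      (*-monoʳ-≤ (binom a (suc g)) (below-mono-weight r a (λ c c<a → h c (<-trans c<a a<m)))))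
    where
    a<m : a < m
    a<m = subst (a <_) eq (m<m+n a z<s)

below-cong : ∀ {x x′} r m → (∀ a → a < m → x a ≡ x′ a) → below x r m ≡ below x′ r m
below-cong r m h = ≤-antisym (below-mono-weight r m (λ a lt → ≤-reflexive (h a lt)))
                             (below-mono-weight r m (λ a lt → ≤-reflexive (sym (h a lt))))

below-mono-step : ∀ x r m → below x r m ≤ below x r (suc m)
below-mono-step x zero    m = ≤-refl
below-mono-step x (suc r) m = begin
  antidiag m (λ a g → positive g * (x a * (binom a g * below x r a)))
    ≤⟨ antidiag-mono m (λ a g _ → *-mono-≤ (positive≤1 g) (*-monoʳ-≤ (x a)
         (*-monoˡ-≤ (below x r a) (binom-monoʳ a (n≤1+n g))))) ⟩
  antidiag m (λ a g → 1 * (x a * (binom a (suc g) * below x r a)))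
    ≤⟨ m≤m+n _ _ ⟩
  antidiag m (λ a g → 1 * (x a * (binom a (suc g) * below x r a))) + _
    ≡⟨ antidiag-last m (λ a g → positive g * (x a * (binom a g * below x r a))) ⟨
  below x (suc r) (suc m) ∎
  where
  open ≤-Reasoning
  positive≤1 : ∀ g → positive g ≤ 1
  positive≤1 zero    = z≤n
  positive≤1 (suc g) = ≤-refl

below-mono-level : ∀ x r {m m′} → m ≤ m′ → below x r m ≤ below x r m′
below-mono-level x r le = go (≤⇒≤′ le)
  where
  go : ∀ {m m′} → m ≤′ m′ → below x r m ≤ below x r m′
  go (≤′-reflexive refl) = ≤-refl
  go (≤′-step p)         = ≤-trans (go p) (below-mono-step x r _)

below-mono : ∀ {x x′} r {m m′} → (∀ a → a < m → x a ≤ x′ a) → m ≤ m′ → below x r m ≤ below x′ r m′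
below-mono r h le = ≤-trans (below-mono-weight r _ h) (below-mono-level _ r le)

below-zero≤1 : ∀ x r → below x r 0 ≤ 1
below-zero≤1 x zero    = ≤-refl
below-zero≤1 x (suc r) = z≤n

-- For `a > 0` a larger set has strictly more subsets of size `a`. The empty set is the exception,
-- hence `x 0 ≡ 0`.
below-strict-level : ∀ x r m → x 0 ≡ 0 → below x (suc r) m ⊏ below x (suc r) (suc m)
below-strict-level x r m x0 = ⊏-≤-trans (antidiag-⊏ m term)
  (≤-trans (m≤m+n _ 0) (≤-reflexive (sym (antidiag-last m summand))))
  where
  summand : ℕ → ℕ → ℕ
  summand a g = positive g * (x a * (binom a g * below x r a))
  term : ∀ a g → a + g ≡ m → positive g * (x a * (binom a g * below x r a)) ⊏
                             1 * (x a * (binom a (suc g) * below x r a))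
  term zero    g eq rewrite x0 = inj₁ (*-zeroʳ (positive g))
  term (suc a) zero    eq = inj₁ refl
  term (suc a) (suc g) eq = ≤-*-⊏ (≤-refl {1}) (≤-*-⊏ (≤-refl {x (suc a)})
    (⊏-*-≤ (inj₂ (binom-strictʳ a (n<1+n (suc g)))) ≤-refl))

-- Strictness enters at the lowest set of the chain, the case `r ≡ 0`: if `m ≤ lo` nothing is
-- counted on the left, and otherwise the sets of level `lo` are additional. The upper sets of the
-- chain preserve `⊏`.
below-strict-weight : ∀ {x x′} r m lo → (∀ a → x a ≤ x′ a) → (∀ a → a ≤ lo → x a ≡ 0) → 0 < x′ lo →
  below x (suc r) m ⊏ below x′ (suc r) m
below-strict-weight {x} {x′} zero m lo x≤x′ x≡0 x′lo with m ≤? lo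
... | yes m≤lo = inj₁ (trans (antidiag-cong m (λ a g eq →
        trans (cong (λ t → positive g * (t * (binom a g * 1))) (x≡0 a (≤-trans (subst (a ≤_) eq (m≤m+n a g)) m≤lo)))
          (*-zeroʳ (positive g)))) (antidiag-zero m))
... | no m≰lo with t , refl ← m≤n⇒∃[o]m+o≡n (≰⇒> m≰lo) =
  inj₂ (antidiag-strict (suc lo + t)
    (λ a g _ → *-monoʳ-≤ (positive g) (*-monoˡ-≤ (binom a g * 1) (x≤x′ a)))
    lo (suc t) (+-suc lo t)
    (subst (λ s → 1 * (s * (binom lo (suc t) * 1)) < 1 * (x′ lo * (binom lo (suc t) * 1)))
      (sym (x≡0 lo ≤-refl))
      (subst (0 <_) (sym (+-identityʳ _))
        (*-mono-< x′lo (subst (0 <_) (sym (*-identityʳ _)) (binom-positive lo (suc t)))))))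
below-strict-weight {x} {x′} (suc r) m lo x≤x′ x≡0 x′lo = antidiag-⊏ m (λ a g _ →
  ≤-*-⊏ (≤-refl {positive g}) (≤-*-⊏ (x≤x′ a) (≤-*-⊏ (≤-refl {binom a g})
    (below-strict-weight r a lo x≤x′ x≡0 x′lo))))

below-positive : ∀ x r m → 0 < below x (suc r) m → ∃ λ a → a < m × 0 < x a × 0 < below x r a
below-positive x r m p with antidiag-positive m _ p
... | a , suc g , eq , q = a , subst (a <_) eq (m<m+n a z<s) , 0<x , 0<b
  where
  q′ : 0 < x a * (binom a (suc g) * below x r a)
  q′ = subst (0 <_) (+-identityʳ _) q
  0<x : 0 < x a
  0<x with x a | q′
  ... | suc _ | _ = z<s
  0<b : 0 < below x r a
  0<b with below x r a | q′
  ... | suc _ | _ = z<s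
  ... | zero | q″ rewrite *-zeroʳ (binom a (suc g)) | *-zeroʳ (x a) = contradiction q″ (λ ())

-- A set of size `2 + m` has at least two subsets of size `suc m`. Each can be the top of a chain:
-- the remaining `r` sets come from the chain given by positivity, with its top removed.
below≥2 : ∀ x r m → 0 < below x (suc r) (2 + m) → 0 < x (suc m) → 2 ≤ below x (suc r) (2 + m)
below≥2 x r m p xm = begin
  2 ≤⟨ s≤s (binom-positive m 1) ⟩
  1 + binom m 1 ≡⟨ +-comm 1 (binom m 1) ⟩
  binom (suc m) 1 ≡⟨ *-identityʳ _ ⟨
  binom (suc m) 1 * 1 ≡⟨ +-identityʳ _ ⟨
  1 * (binom (suc m) 1 * 1) ≡⟨ +-identityʳ _ ⟨
  1 * (1 * (binom (suc m) 1 * 1))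
    ≤⟨ *-monoʳ-≤ 1 (*-mono-≤ xm (*-monoʳ-≤ (binom (suc m) 1) 0<b)) ⟩
  1 * (x (suc m) * (binom (suc m) 1 * below x r (suc m)))
    ≤⟨ antidiag-term (2 + m) (λ a g → positive g * (x a * (binom a g * below x r a))) (suc m) 1 (+-comm (suc m) 1) ⟩
  below x (suc r) (2 + m) ∎
  where
  open ≤-Reasoning
  0<b : 0 < below x r (suc m)
  0<b with a , s≤s a≤m , _ , q ← below-positive x r (2 + m) p = <-≤-trans q (below-mono-level x r a≤m)

-- Both sides count chains whose levels up to a gap have weight x and whose levels above it have weight y:
-- the pivot is the set above the gap on the left and the one below it on the right.
below-slide : ∀ n x y i j →
  antidiag n (λ e d → binom e d * (below x (suc i) e * (y d * below y j d))) ≡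
  antidiag n (λ a b → binom a b * ((x a * below x i a) * below y (suc j) b))
below-slide n x y i j = begin
  antidiag n (λ e d → binom e d * (below x (suc i) e * (y d * below y j d)))
    ≡⟨ antidiag-cong n (λ e d _ → left e d) ⟩
  antidiag n (λ e d → antidiag e (λ a c → term a c d))
    ≡⟨ antidiag-assoc n term ⟩
  antidiag n (λ a b → antidiag b (λ c d → term a c d))
    ≡⟨ antidiag-cong n (λ a b _ → right a b) ⟨
  antidiag n (λ a b → binom a b * ((x a * below x i a) * below y (suc j) b)) ∎
  where
  open ≡-Reasoning
  term : ℕ → ℕ → ℕ → ℕ
  term a c d = positive c * ((binom (a + c) d * binom a c) * ((x a * below x i a) * (y d * below y j d)))
  l₁ : ∀ B p X b P Y → B * ((p * (X * (b * P))) * Y) ≡ p * ((B * b) * ((X * P) * Y))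
  l₁ = solve-∀
  l₂ : ∀ B p Y b Q X → B * (X * (p * (Y * (b * Q)))) ≡ p * ((B * b) * (X * (Y * Q)))
  l₂ = solve-∀
  left : ∀ e d → binom e d * (below x (suc i) e * (y d * below y j d)) ≡ antidiag e (λ a c → term a c d)
  left e d = begin
    binom e d * (below x (suc i) e * (y d * below y j d))
      ≡⟨ cong (binom e d *_) (antidiag-*ʳ e (y d * below y j d) _) ⟨
    binom e d * antidiag e (λ a c → positive c * (x a * (binom a c * below x i a)) * (y d * below y j d))
      ≡⟨ antidiag-*ˡ e (binom e d) _ ⟨
    antidiag e (λ a c → binom e d * (positive c * (x a * (binom a c * below x i a)) * (y d * below y j d)))
      ≡⟨ antidiag-cong e (λ { a c refl →
           l₁ (binom (a + c) d) (positive c) (x a) (binom a c) (below x i a) (y d * below y j d) }) ⟩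
    antidiag e (λ a c → term a c d) ∎
  right : ∀ a b → binom a b * ((x a * below x i a) * below y (suc j) b) ≡ antidiag b (λ c d → term a c d)
  right a b = begin
    binom a b * ((x a * below x i a) * below y (suc j) b)
      ≡⟨ cong (binom a b *_) (antidiag-*ˡ b (x a * below x i a) _) ⟨
    binom a b * antidiag b (λ d c → (x a * below x i a) * (positive c * (y d * (binom d c * below y j d))))
      ≡⟨ antidiag-*ˡ b (binom a b) _ ⟨
    antidiag b (λ d c → binom a b * ((x a * below x i a) * (positive c * (y d * (binom d c * below y j d)))))
      ≡⟨ antidiag-flip b _ ⟩
    antidiag b (λ c d → binom a b * ((x a * below x i a) * (positive c * (y d * (binom d c * below y j d)))))
      ≡⟨ antidiag-cong b (λ { c d refl → trans
           (l₂ (binom a (c + d)) (positive c) (y d) (binom d c) (below y j d) (x a * below x i a))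
           (cong (λ s → positive c * (s * ((x a * below x i a) * (y d * below y j d))))
             (trans (cong (binom a (c + d) *_) (binom-comm d c)) (sym (binom-trinomial a c d)))) }) ⟩
    antidiag b (λ c d → term a c d) ∎

-- Weighted number of chains of r + 1 subsets of an n-set.
chainSum : ℕ → ℕ → (ℕ → ℕ) → ℕ
chainSum n r x = antidiag n (λ a b → binom a b * (x a * below x r a))

-- The sets of a chain switch from `x` to `y` one at a time, from the top down. In `U i j` the pivot
-- still has weight `x`, with `i` sets below and `j` above it; splitting this weight gives
-- `V i j + Z i j`, and `below-slide` moves the pivot of `V` to the next lower set, so the sum
-- telescopes.
chainSum-expand : ∀ n x y (z : ℕ → ℕ) → (∀ a b → a + b ≡ n → x a ≡ y b + z a) → ∀ r →
  chainSum n r x ≡ chainSum n r y +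
    antidiag r (λ s t → antidiag n (λ a b → binom a b * ((z a * below x t a) * below y s b)))
chainSum-expand n x y z h r = begin
  chainSum n r x ≡⟨ antidiag-cong n (λ a b _ → cong (binom a b *_) (sym (*-identityʳ (x a * below x r a)))) ⟩
  U r 0 ≡⟨ expand r 0 ⟩
  V 0 (r + 0) + antidiag r (λ s t → Z t (s + 0))
    ≡⟨ cong₂ _+_ (trans (cong (V 0) (+-identityʳ r)) V≡) (antidiag-cong r (λ s t _ → cong (Z t) (+-identityʳ s))) ⟩
  chainSum n r y + antidiag r (λ s t → Z t s) ∎
  where
  open ≡-Reasoning
  U V Z : ℕ → ℕ → ℕ
  U i j = antidiag n (λ a b → binom a b * ((x a * below x i a) * below y j b))
  V i j = antidiag n (λ a b → binom a b * (below x i a * (y b * below y j b)))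
  Z i j = antidiag n (λ a b → binom a b * ((z a * below x i a) * below y j b))
  distrib : ∀ B p q P Q → B * (((p + q) * P) * Q) ≡ B * (P * (p * Q)) + B * ((q * P) * Q)
  distrib = solve-∀
  U≡ : ∀ i j → U i j ≡ V i j + Z i j
  U≡ i j = trans (antidiag-cong n (λ a b eq →
      trans (cong (λ s → binom a b * ((s * below x i a) * below y j b)) (h a b eq))
        (distrib (binom a b) (y b) (z a) (below x i a) (below y j b))))
    (antidiag-+ n (λ a b → binom a b * (below x i a * (y b * below y j b)))
                  (λ a b → binom a b * ((z a * below x i a) * below y j b)))
  rearrange : ∀ a b c → (a + b) + c ≡ a + (c + b)
  rearrange = solve-∀
  expand : ∀ i j → U i j ≡ V 0 (i + j) + antidiag i (λ s t → Z t (s + j))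
  expand zero    j = U≡ 0 j
  expand (suc i) j = begin
    U (suc i) j ≡⟨ U≡ (suc i) j ⟩
    V (suc i) j + Z (suc i) j ≡⟨ cong (_+ Z (suc i) j) (below-slide n x y i j) ⟩
    U i (suc j) + Z (suc i) j ≡⟨ cong (_+ Z (suc i) j) (expand i (suc j)) ⟩
    V 0 (i + suc j) + antidiag i (λ s t → Z t (s + suc j)) + Z (suc i) j
      ≡⟨ cong₂ (λ p q → V 0 p + q + Z (suc i) j) (+-suc i j)
           (antidiag-cong i (λ s t _ → cong (Z t) (+-suc s j))) ⟩
    V 0 (suc i + j) + antidiag i (λ s t → Z t (suc s + j)) + Z (suc i) j
      ≡⟨ rearrange (V 0 (suc i + j)) _ (Z (suc i) j) ⟩
    V 0 (suc i + j) + antidiag (suc i) (λ s t → Z t (s + j)) ∎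
  V≡ : V 0 r ≡ chainSum n r y
  V≡ = begin
    V 0 r ≡⟨ antidiag-flip n _ ⟩
    antidiag n (λ b a → binom a b * (1 * (y b * below y r b)))
      ≡⟨ antidiag-cong n (λ b a _ → cong₂ _*_ (binom-comm a b) (+-identityʳ _)) ⟩
    chainSum n r y ∎

-- Complementing all sets turns chains around; arithmetically this is the expansion with zero
-- difference.
chainSum-reverse : ∀ n r x y → (∀ a b → a + b ≡ n → x a ≡ y b) → chainSum n r x ≡ chainSum n r y
chainSum-reverse n r x y h = begin
  chainSum n r x
    ≡⟨ chainSum-expand n x y (λ _ → 0) (λ a b eq → trans (h a b eq) (sym (+-identityʳ _))) r ⟩
  chainSum n r y + antidiag r (λ s t → antidiag n (λ a b → binom a b * 0))
    ≡⟨ cong (chainSum n r y +_) (trans (antidiag-cong r (λ s t _ →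
         trans (antidiag-cong n (λ a b _ → *-zeroʳ (binom a b))) (antidiag-zero n))) (antidiag-zero r)) ⟩
  chainSum n r y + 0 ≡⟨ +-identityʳ _ ⟩
  chainSum n r y ∎
  where open ≡-Reasoning

-- Chains of r sets comparable with, and different from, a set with l elements and b non-elements; y is
-- indexed by the number of non-elements.
comparable : (x y : ℕ → ℕ) → ℕ → ℕ → ℕ → ℕ
comparable x y r l b = antidiag r (λ s t → below x t l * below y s b)

comparable-top : ∀ x y r l b → (∀ c → c < b → y c ≡ 0) → comparable x y r l b ≡ below x r l
comparable-top x y r l b h = trans
  (antidiag-single r _ 0 r refl (λ { zero _ _ ne → contradiction refl ne
                                   ; (suc s) t _ _ → trans (cong (below x t l *_) (vanish s)) (*-zeroʳ (below x t l)) }))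
  (*-identityʳ _)
  where
  vanish : ∀ s → below y (suc s) b ≡ 0
  vanish s = trans (antidiag-cong b term) (antidiag-zero b)
    where
    term : ∀ a g → a + g ≡ b → positive g * (y a * (binom a g * below y s a)) ≡ 0
    term a zero    eq = refl
    term a (suc g) eq rewrite h a (subst (a <_) eq (m<m+n a z<s)) = refl

-- Here x weighs levels from below and y weighs the same levels from above, where level l + w has co-level
-- e. A chain around level l is compared with a chain below level l + w by reflecting its part between
-- these two levels.
module _ (x y : ℕ → ℕ) (l e w : ℕ) (e<l : e < l)
         (y-vanishes : ∀ d → d ≤ e → y d ≡ 0) (y≤x : ∀ u → u < w → y (e + u) ≤ x (l + u)) where

  private
    conv : ℕ → ℕ → ℕ
    conv r u = comparable x y r l (e + u)

    lowPart highPart highPart′ : ℕ → ℕ → ℕ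
    lowPart   r u = antidiag l (λ a g → positive g * (positive (g + u) * (x a * (binom a (g + u) * below x r a))))
    highPart  r u = antidiag u (λ a g → positive g * (x (l + a) * (binom (l + a) g * below x r (l + a))))
    highPart′ r u = antidiag u (λ a g → positive g * (y (e + a) * (binom (e + a) g * conv r a)))

    below-split : ∀ r u → below x (suc r) (l + u) ≡ lowPart r u + highPart r u
    below-split r u = antidiag-split l u _

    -- If some set of the chain lies above the given one, take the nearest. Its co-level is `e + a`,
    -- smaller co-levels having weight zero, and the rest of the chain is counted by `conv r a`.
    conv-split : ∀ r u → conv (suc r) u ≡ below x (suc r) l + highPart′ r u
    conv-split r u = cong₂ _+_ (*-identityʳ _) (begin
      antidiag r (λ s t → below x t l * below y (suc s) (e + u))
        ≡⟨ antidiag-cong r (λ s t _ → sym (antidiag-*ˡ (e + u) (below x t l) _)) ⟩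
      antidiag r (λ s t → antidiag (e + u) (λ d g → below x t l * (positive g * (y d * (binom d g * below y s d)))))
        ≡⟨ antidiag-swap r (e + u) _ ⟩
      antidiag (e + u) (λ d g → antidiag r (λ s t → below x t l * (positive g * (y d * (binom d g * below y s d)))))
        ≡⟨ antidiag-cong (e + u) (λ d g _ → collect d g) ⟩
      antidiag (e + u) (λ d g → positive g * (y d * (binom d g * comparable x y r l d)))
        ≡⟨ antidiag-split e u _ ⟩
      antidiag e (λ d g → positive g * (positive (g + u) * (y d * (binom d (g + u) * comparable x y r l d)))) + highPart′ r u
        ≡⟨ cong (_+ highPart′ r u) (trans (antidiag-cong e vanish) (antidiag-zero e)) ⟩
      highPart′ r u ∎)
      where
      open ≡-Reasoning
      l₁ : ∀ P p Y B Q → P * (p * (Y * (B * Q))) ≡ (p * (Y * B)) * (P * Q)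
      l₁ = solve-∀
      l₂ : ∀ p Y B C → (p * (Y * B)) * C ≡ p * (Y * (B * C))
      l₂ = solve-∀
      collect : ∀ d g → antidiag r (λ s t → below x t l * (positive g * (y d * (binom d g * below y s d)))) ≡
                        positive g * (y d * (binom d g * comparable x y r l d))
      collect d g = begin
        antidiag r (λ s t → below x t l * (positive g * (y d * (binom d g * below y s d))))
          ≡⟨ antidiag-cong r (λ s t _ → l₁ (below x t l) (positive g) (y d) (binom d g) (below y s d)) ⟩
        antidiag r (λ s t → (positive g * (y d * binom d g)) * (below x t l * below y s d))
          ≡⟨ antidiag-*ˡ r (positive g * (y d * binom d g)) (λ s t → below x t l * below y s d) ⟩
        (positive g * (y d * binom d g)) * comparable x y r l d
          ≡⟨ l₂ (positive g) (y d) (binom d g) _ ⟩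
        positive g * (y d * (binom d g * comparable x y r l d)) ∎
      vanish : ∀ d g → d + g ≡ e → positive g * (positive (g + u) * (y d * (binom d (g + u) * comparable x y r l d))) ≡ 0
      vanish d g eq rewrite y-vanishes d (subst (d ≤_) eq (m≤m+n d g)) | *-zeroʳ (positive (g + u)) = *-zeroʳ (positive g)

    low-≤ : ∀ r u → below x (suc r) l ≤ lowPart r u
    low-≤ r u = antidiag-mono l term
      where
      term : ∀ a g → a + g ≡ l → positive g * (x a * (binom a g * below x r a)) ≤
               positive g * (positive (g + u) * (x a * (binom a (g + u) * below x r a)))
      term a zero    _ = z≤n
      term a (suc g) _ = *-monoʳ-≤ 1 (≤-trans (*-monoʳ-≤ (x a) (*-monoˡ-≤ (below x r a)
        (binom-monoʳ a (m≤m+n (suc g) u)))) (≤-reflexive (sym (+-identityʳ _))))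

    high-⊏ : ∀ r u → (∀ a → a < u → conv r a ≤ below x r (l + a)) → u ≤ w → highPart′ r u ⊏ highPart r u
    high-⊏ r u ih u≤w = antidiag-⊏ u term
      where
      term : ∀ a g → a + g ≡ u → positive g * (y (e + a) * (binom (e + a) g * conv r a)) ⊏
                                 positive g * (x (l + a) * (binom (l + a) g * below x r (l + a)))
      term a zero    _  = inj₁ refl
      term a (suc g) eq = ≤-*-⊏ (≤-refl {1}) (≤-*-⊏ (y≤x a (<-≤-trans a<u u≤w))
          (⊏-*-≤ (inj₂ (binom-strictˡ g (+-monoˡ-< a e<l))) (ih a a<u)))
        where
        a<u : a < u
        a<u = subst (a <_) eq (m<m+n a z<s)

  -- The nearest set above, of co-level `e + a`, is matched with a top set of level `l + a`. As
  -- `e < l`, the latter are more numerous, and induction on `r` covers the rest. Chains entirely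
  -- below level `l` are matched with those of the same levels below the larger set.
  comparable-≤ : ∀ r u → u ≤ w → comparable x y r l (e + u) ≤ below x r (l + u)
  comparable-≤ zero    u u≤w = ≤-refl
  comparable-≤ (suc r) u u≤w = begin
    conv (suc r) u                     ≡⟨ conv-split r u ⟩
    below x (suc r) l + highPart′ r u
      ≤⟨ +-mono-≤ (low-≤ r u) (⊏⇒≤ (high-⊏ r u (λ a a<u → comparable-≤ r a (≤-trans (<⇒≤ a<u) u≤w)) u≤w)) ⟩
    lowPart r u + highPart r u         ≡⟨ below-split r u ⟨
    below x (suc r) (l + u)            ∎
    where open ≤-Reasoning

  -- If the high part gives no strictness, it contributes nothing to the left. The low part gains
  -- strictly from every top level `a > 0` that contributes, because `w > 0`; what is left is at
  -- most the one chain consisting of the empty set.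
  comparable-strict : x 0 ≤ 1 → 0 < w → ∀ r →
    comparable x y r l (e + w) ≤ 1 ⊎ comparable x y r l (e + w) < below x r (l + w)
  comparable-strict x0≤1 0<w zero    = inj₁ ≤-refl
  comparable-strict x0≤1 0<w (suc r)
    rewrite conv-split r w | below-split r w
    with high-⊏ r w (λ a a<w → comparable-≤ r a (<⇒≤ a<w)) ≤-refl
  ... | inj₂ lt = inj₂ (+-mono-≤-< (low-≤ r w) lt)
  ... | inj₁ eq rewrite eq | +-identityʳ (below x (suc r) l) = low-strict l (≤-<-trans z≤n e<l)
    where
    low-strict : ∀ l → 0 < l → below x (suc r) l ≤ 1 ⊎ below x (suc r) l <
      antidiag l (λ a g → positive g * (positive (g + w) * (x a * (binom a (g + w) * below x r a)))) + highPart r w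
    low-strict (suc l′) _ with antidiag-⊏ l′ term
      where
      term : ∀ a g → a + g ≡ l′ → positive g * (x (suc a) * (binom (suc a) g * below x r (suc a))) ⊏
               positive g * (positive (g + w) * (x (suc a) * (binom (suc a) (g + w) * below x r (suc a))))
      term a zero    _ = inj₁ refl
      term a (suc g) _ = ≤-*-⊏ (≤-refl {1}) (subst (x (suc a) * (binom (suc a) (suc g) * below x r (suc a)) ⊏_)
        (sym (+-identityʳ _)) (≤-*-⊏ (≤-refl {x (suc a)}) (⊏-*-≤ (inj₂ (binom-strictʳ a (m<m+n (suc g) 0<w))) ≤-refl)))
    ... | inj₁ eq′ = inj₁ (subst (_≤ 1) (sym (trans (cong (1 * (x 0 * (1 * below x r 0)) +_) eq′) (+-identityʳ _)))
            (≤-trans (≤-reflexive (+-identityʳ _)) (*-mono-≤ x0≤1 (≤-trans (≤-reflexive (+-identityʳ _)) (below-zero≤1 x r)))))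
    ... | inj₂ lt = inj₂ (<-≤-trans
            (+-mono-≤-< (*-monoʳ-≤ 1 (≤-reflexive (sym (+-identityʳ (x 0 * (1 * below x r 0)))))) lt)
            (m≤m+n _ _))

-- Level patterns and their Lagrangian cost

𝟙 : Bool → ℕ
𝟙 true  = 1
𝟙 false = 0

𝟙≤1 : ∀ b → 𝟙 b ≤ 1
𝟙≤1 true  = ≤-refl
𝟙≤1 false = z≤n

-- A pattern on the levels 0, …, n of the Boolean lattice; values beyond n are irrelevant.
Pattern : Set
Pattern = ℕ → Bool

weight : Pattern → ℕ → ℕ
weight X a = 𝟙 (X a)

reverse : ℕ → Pattern → Pattern
reverse n X a = X (n ∸ a)

update : Pattern → ℕ → Bool → Pattern
update X l v a with a ≟ l
... | yes _ = v
... | no _  = X a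

update-same : ∀ X l v → update X l v l ≡ v
update-same X l v with l ≟ l
... | yes _ = refl
... | no ne = contradiction refl ne

update-other : ∀ X l v {a} → a ≢ l → update X l v a ≡ X a
update-other X l v {a} ne with a ≟ l
... | yes eq = contradiction eq ne
... | no _   = refl

update-id : ∀ X l v → X l ≡ v → ∀ a → update X l v a ≡ X a
update-id X l v eq a with a ≟ l
... | yes refl = sym eq
... | no _     = refl

update-update : ∀ X l u v → X l ≡ v → ∀ a → update (update X l u) l v a ≡ X a
update-update X l u v eq a with a ≟ l
... | yes refl = sym eq
... | no ne    = update-other X l u ne

-- Chains of r + 1 sets in the union of the levels of X, plus D for every set outside this union.
cost : ℕ → ℕ → ℕ → Pattern → ℕ
cost n r D X = chainSum n r (weight X) + D * antidiag n (λ a b → binom a b * 𝟙 (not (X a)))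

cost-cong : ∀ n r D {X X′} → (∀ a → a ≤ n → X a ≡ X′ a) → cost n r D X ≡ cost n r D X′
cost-cong n r D {X} {X′} h = cong₂ (λ s t → s + D * t)
  (antidiag-cong n (λ a b eq → cong (binom a b *_) (cong₂ _*_ (cong 𝟙 (h a (a≤n eq)))
    (below-cong r a (λ c c<a → cong 𝟙 (h c (≤-trans (<⇒≤ c<a) (a≤n eq))))))))
  (antidiag-cong n (λ a b eq → cong (λ v → binom a b * 𝟙 (not v)) (h a (a≤n eq))))
  where
  a≤n : ∀ {a b} → a + b ≡ n → a ≤ n
  a≤n {a} {b} eq = subst (a ≤_) eq (m≤m+n a b)

reverse-apply : ∀ {n} X a b → a + b ≡ n → reverse n X b ≡ X a
reverse-apply X a b refl = cong X (m+n∸n≡m a b)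

cost-reverse : ∀ n r D X → cost n r D (reverse n X) ≡ cost n r D X
cost-reverse n r D X = cong₂ (λ s t → s + D * t)
  (chainSum-reverse n r _ _ (λ a b eq → cong 𝟙 (reverse-apply X b a (trans (+-comm b a) eq))))
  (trans (antidiag-flip n _) (antidiag-cong n (λ a b eq →
    cong₂ (λ s v → s * 𝟙 (not v)) (binom-comm b a) (reverse-apply X a b eq))))

-- The number of chains of `r + 1` sets through one given set of level `l`. For `l + b ≡ n` it does
-- not depend on `X l`, as only levels strictly below and strictly above enter.
degree : ℕ → ℕ → Pattern → ℕ → ℕ → ℕ
degree n r X l b = comparable (weight X) (weight (reverse n X)) r l b

-- Each of the `binom l b` sets of the level costs `D` when missing and `degree` chains when
-- present; moving terms across avoids subtraction. The chain part is `chainSum-expand` with `X₁`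
-- read from below and `X₀` from above: they differ by `δ`, so only pivots on level `l` remain.
cost-toggle : ∀ n r D X l b → l + b ≡ n →
  cost n r D (update X l true) + binom l b * D ≡ cost n r D (update X l false) + binom l b * degree n r X l b
cost-toggle n r D X l b eq = begin
  chainSum n r (weight X₁) + D * missing X₁ + binom l b * D
    ≡⟨ cong (λ s → s + D * missing X₁ + binom l b * D) chains≡ ⟩
  chainSum n r (weight X₀) + binom l b * degree n r X l b + D * missing X₁ + binom l b * D
    ≡⟨ rearrange (chainSum n r (weight X₀)) (binom l b * degree n r X l b) D (missing X₁) (binom l b) ⟩
  chainSum n r (weight X₀) + D * (missing X₁ + binom l b) + binom l b * degree n r X l b
    ≡⟨ cong (λ s → chainSum n r (weight X₀) + D * s + binom l b * degree n r X l b) (sym missing≡) ⟩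
  chainSum n r (weight X₀) + D * missing X₀ + binom l b * degree n r X l b ∎
  where
  open ≡-Reasoning
  X₁ X₀ : Pattern
  X₁ = update X l true
  X₀ = update X l false
  δ : ℕ → ℕ
  δ = weight (update (λ _ → false) l true)
  δ-same : δ l ≡ 1
  δ-same = cong 𝟙 (update-same (λ _ → false) l true)
  δ-other : ∀ {a} → a ≢ l → δ a ≡ 0
  δ-other ne = cong 𝟙 (update-other (λ _ → false) l true ne)
  missing : Pattern → ℕ
  missing X = antidiag n (λ a b → binom a b * 𝟙 (not (X a)))
  rearrange : ∀ K d D M N → K + d + D * M + N * D ≡ K + D * (M + N) + d
  rearrange = solve-∀
  missing≡ : missing X₀ ≡ missing X₁ + binom l b
  missing≡ = begin
    missing X₀ ≡⟨ antidiag-cong n (λ a c _ → trans (cong (binom a c *_) (pointwise a)) (*-distribˡ-+ (binom a c) _ _)) ⟩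
    antidiag n (λ a c → binom a c * 𝟙 (not (X₁ a)) + binom a c * δ a) ≡⟨ antidiag-+ n (λ a c → binom a c * 𝟙 (not (X₁ a))) (λ a c → binom a c * δ a) ⟩
    missing X₁ + antidiag n (λ a c → binom a c * δ a)
      ≡⟨ cong (missing X₁ +_) (trans (antidiag-single n (λ a c → binom a c * δ a) l b eq (λ a c _ ne → trans (cong (binom a c *_) (δ-other ne)) (*-zeroʳ (binom a c))))
           (trans (cong (binom l b *_) δ-same) (*-identityʳ _))) ⟩
    missing X₁ + binom l b ∎
    where
    pointwise : ∀ a → 𝟙 (not (X₀ a)) ≡ 𝟙 (not (X₁ a)) + δ a
    pointwise a with a ≟ l
    ... | yes _ = refl
    ... | no _  = sym (+-identityʳ _)
  weights : ∀ a c → a + c ≡ n → weight X₁ a ≡ weight (reverse n X₀) c + δ a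
  weights a c eq′ rewrite reverse-apply X₀ a c eq′ with a ≟ l
  ... | yes _ = refl
  ... | no _  = sym (+-identityʳ _)
  term : ∀ s t → antidiag n (λ a c → binom a c * ((δ a * below (weight X₁) t a) * below (weight (reverse n X₀)) s c)) ≡
                 binom l b * (below (weight X) t l * below (weight (reverse n X)) s b)
  term s t = trans
    (antidiag-single n _ l b eq (λ a c _ ne → trans (cong (λ z → binom a c * ((z * below (weight X₁) t a) * below (weight (reverse n X₀)) s c)) (δ-other ne)) (*-zeroʳ (binom a c))))
    (cong (binom l b *_) (cong₂ _*_
      (trans (cong (_* below (weight X₁) t l) δ-same) (trans (+-identityʳ _)
        (below-cong t l (λ a a<l → cong 𝟙 (update-other X l true (<⇒≢ a<l))))))
      (below-cong s b (λ c c<b → cong 𝟙 (update-other X l false (λ e → <⇒≢ (above c c<b) (sym e)))))))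
    where
    above : ∀ c → c < b → l < n ∸ c
    above c c<b = m+n≤o⇒m≤o∸n (suc l) (≤-trans (≤-reflexive (sym (+-suc l c)))
      (≤-trans (+-monoʳ-≤ l c<b) (≤-reflexive eq)))
  chains≡ : chainSum n r (weight X₁) ≡ chainSum n r (weight X₀) + binom l b * degree n r X l b
  chains≡ = begin
    chainSum n r (weight X₁) ≡⟨ chainSum-expand n (weight X₁) (weight (reverse n X₀)) δ weights r ⟩
    chainSum n r (weight (reverse n X₀)) + antidiag r (λ s t → antidiag n (λ a c → binom a c * ((δ a * below (weight X₁) t a) * below (weight (reverse n X₀)) s c)))
      ≡⟨ cong₂ _+_ (chainSum-reverse n r _ _ (λ a c e → cong 𝟙 (reverse-apply X₀ c a (trans (+-comm c a) e))))
           (trans (antidiag-cong r (λ s t _ → term s t)) (antidiag-*ˡ r (binom l b) _)) ⟩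
    chainSum n r (weight X₀) + binom l b * degree n r X l b ∎

cost-add : ∀ n r D X l b → l + b ≡ n → X l ≡ false → degree n r X l b < D →
  cost n r D (update X l true) < cost n r D X
cost-add n r D X l b eq Xl d<D = +-cancelʳ-< (binom l b * D) _ _ (begin-strict
  cost n r D (update X l true) + binom l b * D  ≡⟨ cost-toggle n r D X l b eq ⟩
  cost n r D (update X l false) + binom l b * degree n r X l b
    ≡⟨ cong (_+ binom l b * degree n r X l b) (cost-cong n r D (λ a _ → update-id X l false Xl a)) ⟩
  cost n r D X + binom l b * degree n r X l b
    <⟨ +-monoʳ-< (cost n r D X) (*-monoʳ-< (binom l b) {{>-nonZero (binom-positive l b)}} d<D) ⟩
  cost n r D X + binom l b * D ∎)
  where open ≤-Reasoning

cost-drop : ∀ n r D X l b → l + b ≡ n → X l ≡ true → D < degree n r X l b →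
  cost n r D (update X l false) < cost n r D X
cost-drop n r D X l b eq Xl D<d = +-cancelʳ-< (binom l b * degree n r X l b) _ _ (begin-strict
  cost n r D (update X l false) + binom l b * degree n r X l b ≡⟨ cost-toggle n r D X l b eq ⟨
  cost n r D (update X l true) + binom l b * D
    ≡⟨ cong (_+ binom l b * D) (cost-cong n r D (λ a _ → update-id X l true Xl a)) ⟩
  cost n r D X + binom l b * D
    <⟨ +-monoʳ-< (cost n r D X) (*-monoʳ-< (binom l b) {{>-nonZero (binom-positive l b)}} D<d) ⟩
  cost n r D X + binom l b * degree n r X l b ∎)
  where open ≤-Reasoning

-- With savings `ε = D - d₂` and `δ = D - d₁` per set, `x = y - p ε` and `z = y - q δ`, where
-- `ε ≤ δ`, `0 < δ` and `p < q`.
exchange-arith : ∀ {p q y x z d₁ d₂ D} → x + p * D ≡ y + p * d₂ → z + q * D ≡ y + q * d₁ →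
  p < q → d₁ < D → d₁ ≤ d₂ → d₂ ≤ D → z < x
exchange-arith {p} {q} {y} {x} {z} {d₁} {d₂} xe ze p<q d₁<D d₁≤d₂ d₂≤D
  with ε , refl ← m≤n⇒∃[o]m+o≡n d₂≤D
  with δ , eqδ ← m≤n⇒∃[o]m+o≡n (<⇒≤ d₁<D) = +-cancelʳ-< (q * δ) z x (begin-strict
    z + q * δ ≡⟨ shift z y q d₁ δ (trans (cong (λ s → z + q * s) eqδ) ze) ⟩
    y         ≡⟨ shift x y p d₂ ε xe ⟨
    x + p * ε ≤⟨ +-monoʳ-≤ x (*-monoʳ-≤ p ε≤δ) ⟩
    x + p * δ <⟨ +-monoʳ-< x (*-monoˡ-< δ {{>-nonZero 0<δ}} p<q) ⟩
    x + q * δ ∎)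
  where
  open ≤-Reasoning
  rearrange : ∀ z q d δ → z + q * (d + δ) ≡ z + q * δ + q * d
  rearrange = solve-∀
  shift : ∀ z y q d δ → z + q * (d + δ) ≡ y + q * d → z + q * δ ≡ y
  shift z y q d δ e = +-cancelʳ-≡ (q * d) _ _ (trans (sym (rearrange z q d δ)) e)
  ε≤δ : ε ≤ δ
  ε≤δ = +-cancelˡ-≤ d₁ ε δ (≤-trans (+-monoˡ-≤ ε d₁≤d₂) (≤-reflexive (sym eqδ)))
  0<δ : 0 < δ
  0<δ = +-cancelˡ-< d₁ 0 δ (subst₂ _<_ (sym (+-identityʳ d₁)) (sym eqδ) d₁<D)

-- Intervals of levels and good patterns

interval : ℕ → ℕ → Pattern
interval lo hi a with lo ≤? a | a <? hi
... | yes _ | yes _ = true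
... | _     | _     = false

interval-true : ∀ {lo hi a} → lo ≤ a → a < hi → interval lo hi a ≡ true
interval-true {lo} {hi} {a} p q with lo ≤? a | a <? hi
... | yes _ | yes _ = refl
... | no ¬p | _     = contradiction p ¬p
... | yes _ | no ¬q = contradiction q ¬q

interval-true⁻¹ : ∀ {lo hi a} → interval lo hi a ≡ true → lo ≤ a × a < hi
interval-true⁻¹ {lo} {hi} {a} eq with lo ≤? a | a <? hi
... | yes p | yes q = p , q

weight-mono : ∀ {X Y a} → (X a ≡ true → Y a ≡ true) → weight X a ≤ weight Y a
weight-mono {X} {Y} {a} h with X a
... | false = z≤n
... | true rewrite h refl = ≤-refl

weight-false : ∀ {X a} → ¬ (X a ≡ true) → weight X a ≡ 0
weight-false {X} {a} h with X a
... | false = refl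
... | true  = contradiction refl h

-- How far the outermost pair of levels `e` and `m` is filled: in `first` no maximal chain meets the
-- family on both levels, in `second` each one meets it on at least one.
data Stage : Set where
  first second : Stage

stageLow : Stage → ℕ → ℕ
stageLow first  e = suc e
stageLow second e = e

-- The number of new chains per m-set when level m is added to the levels (e , m), or to [e , m).
multiplier : ℕ → Stage → ℕ → ℕ → ℕ
multiplier r s e m = below (weight (interval (stageLow s e) m)) r m

record Between (n e m : ℕ) (X : Pattern) : Set where
  field
    inner : ∀ a → e < a → a < m → X a ≡ true
    outer : ∀ a → a ≤ n → X a ≡ true → e ≤ a × a ≤ m

record Good (n : ℕ) (s : Stage) (e m : ℕ) (X : Pattern) : Set where
  field
    between : Between n e m X
  open Between between public
  field
    outermost-first  : s ≡ first → ¬ (X e ≡ true × X m ≡ true)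
    outermost-second : s ≡ second → X e ≡ true ⊎ X m ≡ true

module _ {n : ℕ} {s : Stage} {e m : ℕ} (e+m : e + m ≡ n) where

  n∸e : n ∸ e ≡ m
  n∸e = trans (cong (_∸ e) (sym e+m)) (m+n∸m≡n e m)

  n∸m : n ∸ m ≡ e
  n∸m = trans (cong (_∸ m) (sym e+m)) (m+n∸n≡m e m)

  Good-reverse : ∀ {X} → Good n s e m X → Good n s e m (reverse n X)
  Good-reverse {X} g = record
    { between = record { inner = λ a e<a a<m → Good.inner g (n ∸ a)
        (subst (_< n ∸ a) n∸m (∸-monoʳ-< a<m m≤n))
        (subst (n ∸ a <_) n∸e (∸-monoʳ-< e<a (≤-trans (<⇒≤ a<m) m≤n)))
    ; outer = λ a a≤n Xa → let e≤ , ≤m = Good.outer g (n ∸ a) (m∸n≤m n a) Xa in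
        subst₂ _≤_ n∸m (m∸[m∸n]≡n a≤n) (∸-monoʳ-≤ n ≤m) ,
        subst₂ _≤_ (m∸[m∸n]≡n a≤n) n∸e (∸-monoʳ-≤ n e≤) }
    ; outermost-first = λ { eq (p , q) → Good.outermost-first g eq
        (subst (λ t → X t ≡ true) n∸m q , subst (λ t → X t ≡ true) n∸e p) }
    ; outermost-second = λ eq → swapped (Good.outermost-second g eq)
    }
    where
    m≤n : m ≤ n
    m≤n = subst (m ≤_) e+m (m≤n+m m e)
    swapped : X e ≡ true ⊎ X m ≡ true → reverse n X e ≡ true ⊎ reverse n X m ≡ true
    swapped (inj₁ p) = inj₂ (subst (λ t → X t ≡ true) (sym n∸m) p)
    swapped (inj₂ p) = inj₁ (subst (λ t → X t ≡ true) (sym n∸e) p)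

HighestGap : Pattern → ℕ → ℕ → Set
HighestGap X E M = ∃ λ l → E < l × l < M × X l ≡ false × (∀ a → l < a → a < M → X a ≡ true)

full-or-gap : ∀ X E M → (∀ a → E < a → a < M → X a ≡ true) ⊎ HighestGap X E M
full-or-gap X E zero    = inj₁ (λ _ _ ())
full-or-gap X E (suc M) with E <? M | X M in eq
... | no E≮M | _ = inj₁ (λ a E<a a≤M → contradiction (<-≤-trans E<a (≤-pred a≤M)) E≮M)
... | yes E<M | false = inj₂ (M , E<M , n<1+n M , eq , λ a M<a a≤M → contradiction (≤-pred a≤M) (<⇒≱ M<a))
... | yes E<M | true with full-or-gap X E M
...   | inj₁ full = inj₁ (λ a E<a a≤M → extend a E<a (m≤n⇒m<n∨m≡n (≤-pred a≤M)))
  where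
  extend : ∀ a → E < a → a < M ⊎ a ≡ M → X a ≡ true
  extend a E<a (inj₁ a<M)  = full a E<a a<M
  extend a E<a (inj₂ refl) = eq
...   | inj₂ (l , E<l , l<M , Xl , above) =
  inj₂ (l , E<l , m<n⇒m<1+n l<M , Xl , λ a l<a a≤M → extend a l<a (m≤n⇒m<n∨m≡n (≤-pred a≤M)))
  where
  extend : ∀ a → l < a → a < M ⊎ a ≡ M → X a ≡ true
  extend a l<a (inj₁ a<M)  = above a l<a a<M
  extend a l<a (inj₂ refl) = eq

Within : ℕ → ℕ → ℕ → Pattern → Set
Within n E M X = ∀ a → a ≤ n → X a ≡ true → E ≤ a × a ≤ M

degree-top : ∀ {n} r X M E → M + E ≡ n → (∀ a → M < a → a ≤ n → X a ≡ false) →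
  degree n r X M E ≡ below (weight X) r M
degree-top {n} r X M E eq h = comparable-top _ _ r M E (λ c c<E →
  cong 𝟙 (h (n ∸ c) (m+n≤o⇒m≤o∸n (suc M) (≤-trans (≤-reflexive (sym (+-suc M c)))
      (≤-trans (+-monoʳ-≤ M c<E) (≤-reflexive eq)))) (m∸n≤m n c)))

≤stageLow : ∀ s e → e ≤ stageLow s e
≤stageLow first  e = n≤1+n e
≤stageLow second e = ≤-refl

interval-widen : ∀ lo hi a → weight (interval (suc lo) hi) a ≤ weight (interval lo hi) a
interval-widen lo hi a = weight-mono {interval (suc lo) hi} {interval lo hi}
  (λ eq → let p , q = interval-true⁻¹ eq in interval-true (<⇒≤ p) q)

multiplier-first≤ : ∀ r s e m → multiplier r first e m ≤ multiplier r s e m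
multiplier-first≤ r first  e m = ≤-refl
multiplier-first≤ r second e m = below-mono-weight r m (λ a _ → interval-widen e m a)

-- Minimisers of the cost

module Optimisation (n r : ℕ) (s : Stage) (e m : ℕ) (e+m : e + m ≡ n) (e<m : e < m)
                    (positive-D : 0 < multiplier (suc r) s e m) where

  D : ℕ
  D = multiplier (suc r) s e m

  price : Pattern → ℕ
  price = cost n (suc r) D

  Improvable : Pattern → Set
  Improvable X = ∃ λ X′ → price X′ < price X

  D-interval : ∃ λ a → stageLow s e ≤ a × a < m
  D-interval with below-positive _ r m positive-D
  ... | a , a<m , 0<x , _ = a , proj₁ (interval-true⁻¹ (true-of _ 0<x)) , a<m
    where
    true-of : ∀ b → 0 < 𝟙 b → b ≡ true
    true-of true _ = refl

  -- comparable-strict is not strict only if the empty set is alone below the gap; then the degree is at most 1.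
  2≤D : 2 ≤ n → 2 ≤ D
  2≤D 2≤n = go m refl
    where
    go : ∀ k → k ≡ m → 2 ≤ D
    go zero    refl = contradiction e<m (λ ())
    go (suc zero) refl = contradiction 2≤n (<⇒≱ (subst (_< 2) (trans (+-comm 1 e) e+m) (s≤s e<m)))
    go (suc (suc k)) refl = below≥2 (weight (interval (stageLow s e) (2 + k))) r k positive-D
      (subst (λ b → 0 < 𝟙 b) (sym (interval-true low≤ ≤-refl)) z<s)
      where
      low≤ : stageLow s e ≤ suc k
      low≤ = ≤-trans (proj₁ (proj₂ D-interval)) (≤-pred (proj₂ (proj₂ D-interval)))

  module Top (X : Pattern) (M E : ℕ) (M+E : M + E ≡ n) (E≤M : E ≤ M)
             (within : Within n E M X) (XM : X M ≡ true) where

    M≤n : M ≤ n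
    M≤n = subst (M ≤_) M+E (m≤m+n M E)

    beyond : ∀ a → M < a → a ≤ n → X a ≡ false
    beyond a M<a a≤n = ¬-not (λ Xa → <⇒≱ M<a (proj₂ (within a a≤n Xa)))

    -- `Y` lacks both levels, and `d₂`, `d₁` are the chains created per set when `M` or `l` is added
    -- to it. If `D < d₂`, level `M` is not worth keeping. Otherwise `d₁ ≤ d₂ ≤ D`: level `l` has
    -- more sets, and each of them saves at least as much, so `Z` is cheaper than `X`.
    gap-case : HighestGap X E M → Improvable X
    gap-case (l , E<l , l<M , Xl , above) = improve
      where
      Y Z : Pattern
      Y = update X M false
      Z = update Y l true
      w : ℕ
      w = M ∸ l
      l+w : l + w ≡ M
      l+w = m+[n∸m]≡n (<⇒≤ l<M)
      l+b : l + (E + w) ≡ n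
      l+b = trans (shuffle l E w) (trans (cong (_+ E) l+w) M+E)
        where
        shuffle : ∀ l E w → l + (E + w) ≡ l + w + E
        shuffle = solve-∀
      d₁ d₂ : ℕ
      d₁ = degree n (suc r) Y l (E + w)
      d₂ = below (weight Y) (suc r) M
      Y-M : Y M ≡ false
      Y-M = update-same X M false
      Y-beyond : ∀ a → M ≤ a → a ≤ n → Y a ≡ false
      Y-beyond a M≤a a≤n with a ≟ M
      ... | yes _ = refl
      ... | no ne = beyond a (≤∧≢⇒< M≤a (λ e → ne (sym e))) a≤n
      y-vanishes : ∀ d → d ≤ E → weight (reverse n Y) d ≡ 0
      y-vanishes d d≤E = cong 𝟙 (Y-beyond (n ∸ d)
        (≤-trans (≤-reflexive (trans (sym (m+n∸n≡m M E)) (cong (_∸ E) M+E))) (∸-monoʳ-≤ n d≤E)) (m∸n≤m n d))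
      -- Reflection between `l` and `M` must land in levels of `Y`; this holds because `l` is the
      -- highest gap. At `u ≡ 0` the reflected level is `M`, which `Y` lacks.
      y≤x : ∀ u → u < w → weight (reverse n Y) (E + u) ≤ weight Y (l + u)
      y≤x zero    _   rewrite +-identityʳ E | y-vanishes E ≤-refl = z≤n
      y≤x (suc u) u<w = ≤-trans (𝟙≤1 _) (≤-reflexive (sym (cong 𝟙
        (trans (update-other X M false (<⇒≢ l+u<M)) (above (l + suc u) (m<m+n l z<s) l+u<M)))))
        where
        l+u<M : l + suc u < M
        l+u<M = subst (l + suc u <_) l+w (+-monoʳ-< l u<w)
      d₁≤d₂ : d₁ ≤ d₂
      d₁≤d₂ = subst (λ t → d₁ ≤ below (weight Y) (suc r) t) l+w
        (comparable-≤ (weight Y) (weight (reverse n Y)) l E w E<l y-vanishes y≤x (suc r) w ≤-refl)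
      2≤n : 2 ≤ n
      2≤n = ≤-trans (s≤s (≤-<-trans z≤n E<l)) (≤-trans l<M M≤n)
      d₁<D : d₂ ≤ D → d₁ < D
      d₁<D d₂≤D with comparable-strict (weight Y) (weight (reverse n Y)) l E w E<l y-vanishes y≤x
                       (𝟙≤1 _) (m<n⇒0<n∸m l<M) (suc r)
      ... | inj₁ d₁≤1  = <-≤-trans (s≤s d₁≤1) (2≤D 2≤n)
      ... | inj₂ d₁<d₂ = <-≤-trans (subst (λ t → d₁ < below (weight Y) (suc r) t) l+w d₁<d₂) d₂≤D
      degree-M : degree n (suc r) Y M E ≡ d₂
      degree-M = degree-top (suc r) Y M E M+E (λ a M<a → Y-beyond a (<⇒≤ M<a))
      toggle-M : price X + binom M E * D ≡ price Y + binom M E * d₂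
      toggle-M = begin
        price X + binom M E * D
          ≡⟨ cong (_+ binom M E * D) (cost-cong n (suc r) D (λ a _ → sym (update-update X M false true XM a))) ⟩
        price (update Y M true) + binom M E * D ≡⟨ cost-toggle n (suc r) D Y M E M+E ⟩
        price (update Y M false) + binom M E * degree n (suc r) Y M E
          ≡⟨ cong₂ (λ p q → p + binom M E * q) (cost-cong n (suc r) D (λ a _ → update-id Y M false Y-M a)) degree-M ⟩
        price Y + binom M E * d₂ ∎
        where open ≡-Reasoning
      toggle-l : price Z + binom l (E + w) * D ≡ price Y + binom l (E + w) * d₁
      toggle-l = trans (cost-toggle n (suc r) D Y l (E + w) l+b)
        (cong (_+ binom l (E + w) * d₁) (cost-cong n (suc r) D (λ a _ → update-id Y l false
          (trans (update-other X M false (<⇒≢ l<M)) Xl) a)))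
      improve : Improvable X
      improve with D <? d₂
      ... | yes D<d₂ = Y , +-cancelʳ-< (binom M E * d₂) (price Y) (price X) (begin-strict
          price Y + binom M E * d₂ ≡⟨ toggle-M ⟨
          price X + binom M E * D
            <⟨ +-monoʳ-< (price X) (*-monoʳ-< (binom M E) {{>-nonZero (binom-positive M E)}} D<d₂) ⟩
          price X + binom M E * d₂ ∎)
        where open ≤-Reasoning
      ... | no D≮d₂ = Z , exchange-arith {y = price Y} toggle-M toggle-l
          (binom-unimodal {l} {E + w} (trans l+b (sym M+E)) E<l (m<m+n E (m<n⇒0<n∸m l<M)))
          (d₁<D (≮⇒≥ D≮d₂)) d₁≤d₂ (≮⇒≥ D≮d₂)

    module NoGap (full : ∀ a → E < a → a < M → X a ≡ true) where

      drop-top : D < below (weight X) (suc r) M → Improvable X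
      drop-top D<d = update X M false , cost-drop n (suc r) D X M E M+E XM
        (subst (D <_) (sym (degree-top (suc r) X M E M+E beyond)) D<d)

      strictly : ∀ {p q} → p ⊏ q → p ≡ D → D < q
      strictly (inj₂ lt) refl = lt
      strictly (inj₁ z) eq = contradiction (trans (sym eq) z) (>⇒≢ positive-D)

      -- Here `E < e`, so `X` contains every level that enters `D`, and level 0 is not among these.
      -- Seen from level `M` instead of `m` they carry more chains, so each set of level `M` costs
      -- more than `D`.
      above-case : m < M → Improvable X
      above-case m<M = drop-top (<-≤-trans
        (strictly (below-strict-level (weight (interval (stageLow s e) m)) r m (weight-false {interval (stageLow s e) m} {0} not-zero)) refl)
        (below-mono {weight (interval (stageLow s e) m)} {weight X} (suc r) (λ a _ → weight-mono {interval (stageLow s e) m} {X} (covered a)) m<M))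
        where
        E<e : E < e
        E<e = +-cancelʳ-< m E e (<-≤-trans (+-monoʳ-< E m<M) (≤-reflexive (trans (+-comm E M) (trans M+E (sym e+m)))))
        e≤low : e ≤ stageLow s e
        e≤low = ≤stageLow s e
        not-zero : ¬ (interval (stageLow s e) m 0 ≡ true)
        not-zero eq = contradiction (≤-<-trans z≤n E<e)
          (≤⇒≯ (≤-trans e≤low (proj₁ (interval-true⁻¹ eq))))
        covered : ∀ a → interval (stageLow s e) m a ≡ true → X a ≡ true
        covered a eq = full a (<-≤-trans E<e (≤-trans e≤low (proj₁ (interval-true⁻¹ eq))))
                             (<-trans (proj₂ (interval-true⁻¹ eq)) m<M)

      middle-case : M ≡ m → E ≡ e → Good n s e m X ⊎ Improvable X
      middle-case refl refl = by-stage s refl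
        where
        good : (s ≡ first → X E ≡ false) → Good n s E M X
        good ne = record
          { between = record { inner = full ; outer = within }
          ; outermost-first = λ { eq (XE , _) → contradiction (trans (sym XE) (ne eq)) (λ ()) }
          ; outermost-second = λ _ → inj₂ XM }
        by-stage : ∀ s′ → s ≡ s′ → Good n s E M X ⊎ Improvable X
        by-stage second refl = inj₁ (good (λ ()))
        by-stage first  refl with X E in XE
        ... | false = inj₁ (good (λ _ → XE))
        -- Both outermost levels are present, so a set of level `m` sees also level `e`, which the
        -- multiplier of `first` leaves out.
        ... | true  = inj₂ (drop-top (<-≤-trans
                (strictly (below-strict-weight r M E (interval-widen E M) vanish (subst (λ b → 0 < 𝟙 b) (sym (interval-true ≤-refl e<m)) z<s)) refl)
                (below-mono-weight (suc r) M (λ a _ → weight-mono {interval E M} {X} (covered a)))))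
          where
          vanish : ∀ a → a ≤ E → weight (interval (suc E) M) a ≡ 0
          vanish a a≤E = weight-false {interval (suc E) M} (λ eq → <⇒≱ (proj₁ (interval-true⁻¹ eq)) a≤E)
          covered : ∀ a → interval E M a ≡ true → X a ≡ true
          covered a eq with m≤n⇒m<n∨m≡n (proj₁ (interval-true⁻¹ eq))
          ... | inj₁ E<a  = full a E<a (proj₂ (interval-true⁻¹ eq))
          ... | inj₂ refl = XE

      module Below (M<m : M < m) where
        e<E : e < E
        e<E = +-cancelʳ-< M e E (<-≤-trans (+-monoʳ-< e M<m) (≤-reflexive (trans e+m (trans (sym M+E) (+-comm M E)))))
        E⁻ : ℕ
        E⁻ = pred E
        E≡suc : E ≡ suc E⁻
        E≡suc = sym (suc-pred E {{>-nonZero (≤-<-trans z≤n e<E)}})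
        sM+E⁻ : suc M + E⁻ ≡ n
        sM+E⁻ = trans (sym (+-suc M E⁻)) (trans (cong (M +_) (sym E≡suc)) M+E)
        sM≤n : suc M ≤ n
        sM≤n = subst (suc M ≤_) sM+E⁻ (m≤m+n (suc M) E⁻)

        add-next : below (weight X) (suc r) (suc M) < D → Improvable X
        add-next d<D = update X (suc M) true , cost-add n (suc r) D X (suc M) E⁻ sM+E⁻
          (beyond (suc M) ≤-refl sM≤n)
          (subst (_< D) (sym (degree-top (suc r) X (suc M) E⁻ sM+E⁻ (λ a lt → beyond a (<⇒≤ lt)))) d<D)

        below-D : ∀ {p q} → p ⊏ q → q ≤ D → p < D
        below-D (inj₁ refl) _  = positive-D
        below-D (inj₂ lt)   le = <-≤-trans lt le

        X≤ : ∀ lo hi a → lo ≤ E → M < hi → a < suc M → weight X a ≤ weight (interval lo hi) a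
        X≤ lo hi a lo≤E M<hi a≤M = weight-mono {X} {interval lo hi} (λ Xa →
          interval-true (≤-trans lo≤E (proj₁ (within a (≤-trans (≤-pred a≤M) M≤n) Xa))) (<-≤-trans a≤M M<hi))

        first≤D : below (weight (interval (suc e) m)) (suc r) m ≤ D
        first≤D = multiplier-first≤ (suc r) s e m

        -- A set of level `suc M` sees only levels inside `(e , m)`, and from a level below `m`,
        -- hence fewer than `D` chains: adding its level pays.
        far : suc M < m → Improvable X
        far sM<m = add-next (below-D
          (≤-⊏-trans (below-mono-weight (suc r) (suc M) (λ a → X≤ (suc e) m a e<E M<m))
            (below-strict-level (weight (interval (suc e) m)) r (suc M) (weight-false {interval (suc e) m} {0} (λ eq → contradiction (proj₁ (interval-true⁻¹ {suc e} {m} {0} eq)) (λ ())))))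
          (≤-trans (below-mono-level (weight (interval (suc e) m)) (suc r) sM<m) first≤D))

        raise-low : ∀ lo → lo < suc M → weight (interval lo (suc M)) lo ≡ 1 →
          below (weight (interval (suc lo) (suc M))) (suc r) (suc M) ⊏ below (weight (interval lo (suc M))) (suc r) (suc M)
        raise-low lo lt eq = below-strict-weight r (suc M) lo
          (interval-widen lo (suc M))
          (λ a a≤lo → weight-false {interval (suc lo) (suc M)} (λ eq → <⇒≱ (proj₁ (interval-true⁻¹ eq)) a≤lo))
          (subst (0 <_) (sym eq) z<s)

        -- In stage `second`, `D` counts level `e`, which `X` lacks, so adding level `m` pays. In
        -- stage `first` the same argument applies to level `E` if it is absent; if it is present,
        -- `X` consists of exactly the levels of `(e , m)`.
        near : suc M ≡ m → E ≡ suc e → Good n s e m X ⊎ Improvable X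
        near refl refl = by-stage s refl
          where
          e<sM : e < suc M
          e<sM = ≤-trans E≤M (n≤1+n M)
          by-stage : ∀ s′ → s ≡ s′ → Good n s e (suc M) X ⊎ Improvable X
          by-stage second refl = inj₂ (add-next (below-D
            (≤-⊏-trans (below-mono-weight (suc r) (suc M) (λ a → X≤ (suc e) (suc M) a ≤-refl ≤-refl))
              (raise-low e e<sM (cong 𝟙 (interval-true ≤-refl e<sM)))) ≤-refl))
          by-stage first refl with X E in XE
          ... | false = inj₂ (add-next (below-D
                  (≤-⊏-trans (below-mono-weight (suc r) (suc M) shrink)
                    (raise-low E (s≤s E≤M) (cong 𝟙 (interval-true ≤-refl (s≤s E≤M))))) ≤-refl))
            where
            shrink : ∀ a → a < suc M → weight X a ≤ weight (interval (suc E) (suc M)) a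
            shrink a a≤M = weight-mono {X} {interval (suc E) (suc M)} (λ Xa → interval-true
              (≤∧≢⇒< (proj₁ (within a (≤-trans (≤-pred a≤M) M≤n) Xa))
                     (λ { refl → contradiction (trans (sym Xa) XE) (λ ()) })) a≤M)
          ... | true = inj₁ (record
                  { between = record
                      { inner = inner
                      ; outer = λ a a≤n Xa → let p , q = within a a≤n Xa in <⇒≤ p , m≤n⇒m≤1+n q }
                  ; outermost-first = λ { _ (Xe , _) → <⇒≱ (n<1+n e) (proj₁ (within e e≤n Xe)) }
                  ; outermost-second = λ () })
            where
            e≤n : e ≤ n
            e≤n = subst (e ≤_) e+m (m≤m+n e (suc M))
            inner : ∀ a → e < a → a < suc M → X a ≡ true
            inner a e<a a≤M with m≤n⇒m<n∨m≡n e<a | m≤n⇒m<n∨m≡n (≤-pred a≤M)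
            ... | inj₂ refl | _         = XE
            ... | inj₁ E<a  | inj₁ a<M  = full a E<a a<M
            ... | inj₁ E<a  | inj₂ refl = XM

        below-case : Good n s e m X ⊎ Improvable X
        below-case with m≤n⇒m<n∨m≡n M<m
        ... | inj₁ sM<m = inj₂ (far sM<m)
        ... | inj₂ sM≡m = near sM≡m (+-cancelʳ-≡ M E (suc e)
                (trans (+-comm E M) (trans M+E (trans (sym e+m) (trans (cong (e +_) (sym sM≡m)) (+-suc e M))))))

    top-case : Good n s e m X ⊎ Improvable X
    top-case with full-or-gap X E M
    ... | inj₂ gap  = inj₂ (gap-case gap)
    ... | inj₁ full with <-cmp M m
    ...   | tri> _ _ m<M = inj₂ (NoGap.above-case full m<M)
    ...   | tri< M<m _ _ = NoGap.Below.below-case full M<m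
    ...   | tri≈ _ M≡m _ = NoGap.middle-case full M≡m
              (+-cancelʳ-≡ M E e (trans (+-comm E M) (trans M+E (trans (sym e+m) (cong (e +_) (sym M≡m))))))

  empty-case : ∀ X → (∀ a → a ≤ n → X a ≡ false) → Improvable X
  empty-case X empty = update X m true , cost-add n (suc r) D X m e (trans (+-comm m e) e+m) (empty m m≤n)
    (subst (_< D) (sym (trans (degree-top (suc r) X m e (trans (+-comm m e) e+m) (λ a _ → empty a)) zero-below)) positive-D)
    where
    m≤n : m ≤ n
    m≤n = subst (m ≤_) e+m (m≤n+m m e)
    zero-below : below (weight X) (suc r) m ≡ 0
    zero-below = n≤0⇒n≡0 (≮⇒≥ (λ p → let a , a<m , 0<x , _ = below-positive (weight X) r m p in
      contradiction (subst (0 <_) (cong 𝟙 (empty a (≤-trans (<⇒≤ a<m) m≤n))) 0<x) (λ ())))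

  -- The window `[E , M]` shrinks symmetrically while both its ends are absent from `X`. A present
  -- end is farthest from the middle; if only the lower one is present, reversal makes it the upper
  -- one.
  good-or-improvable-within : ∀ M E X → M + E ≡ n → E ≤ M → Within n E M X → Good n s e m X ⊎ Improvable X
  good-or-improvable-within M E X eq E≤M within with X M in XM | X E in XE
  ... | true | _ = Top.top-case X M E eq E≤M within XM
  ... | false | true with Top.top-case (reverse n X) M E eq E≤M within′ (trans (reverse-apply X E M (trans (+-comm E M) eq)) XE)
    where
    E≡ : n ∸ M ≡ E
    E≡ = trans (cong (_∸ M) (sym eq)) (m+n∸m≡n M E)
    M≡ : n ∸ E ≡ M
    M≡ = trans (cong (_∸ E) (sym eq)) (m+n∸n≡m M E)
    within′ : Within n E M (reverse n X)
    within′ a a≤n Xa = let p , q = within (n ∸ a) (m∸n≤m n a) Xa in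
      subst₂ _≤_ E≡ (m∸[m∸n]≡n a≤n) (∸-monoʳ-≤ n q) , subst₂ _≤_ (m∸[m∸n]≡n a≤n) M≡ (∸-monoʳ-≤ n p)
  ...   | inj₁ good = inj₁ (unreverse (Good-reverse e+m good))
    where
    unreverse : Good n s e m (reverse n (reverse n X)) → Good n s e m X
    unreverse g = record
      { between = record
          { inner = λ a e<a a<m → trans (sym (twice a (≤-trans (<⇒≤ a<m) m≤n))) (Good.inner g a e<a a<m)
          ; outer = λ a a≤n Xa → Good.outer g a a≤n (trans (twice a a≤n) Xa) }
      ; outermost-first = λ { st (p , q) → Good.outermost-first g st (trans (twice e e≤n) p , trans (twice m m≤n) q) }
      ; outermost-second = λ st → back (Good.outermost-second g st) }
      where
      m≤n : m ≤ n
      m≤n = subst (m ≤_) e+m (m≤n+m m e)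
      e≤n : e ≤ n
      e≤n = subst (e ≤_) e+m (m≤m+n e m)
      twice : ∀ a → a ≤ n → reverse n (reverse n X) a ≡ X a
      twice a a≤n = cong X (m∸[m∸n]≡n a≤n)
      back : reverse n (reverse n X) e ≡ true ⊎ reverse n (reverse n X) m ≡ true → X e ≡ true ⊎ X m ≡ true
      back (inj₁ p) = inj₁ (trans (sym (twice e e≤n)) p)
      back (inj₂ p) = inj₂ (trans (sym (twice m m≤n)) p)
  ...   | inj₂ (X′ , lt) = inj₂ (X′ , subst (price X′ <_) (cost-reverse n (suc r) D X) lt)
  good-or-improvable-within zero    E X eq E≤M within | false | false =
    contradiction (≤-<-trans z≤n e<m) (≤⇒≯ (≤-trans (m≤n+m m e) (≤-trans (≤-reflexive (trans e+m (sym eq))) E≤M)))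
  good-or-improvable-within (suc M) E X eq E≤M within | false | false with suc E ≤? M
  ... | yes sE≤M = good-or-improvable-within M (suc E) X (trans (+-suc M E) eq) sE≤M shrunk
    where
    shrunk : Within n (suc E) M X
    shrunk a a≤n Xa = let p , q = within a a≤n Xa in
      ≤∧≢⇒< p (λ { refl → contradiction (trans (sym Xa) XE) (λ ()) }) ,
      ≤-pred (≤∧≢⇒< q (λ { refl → contradiction (trans (sym Xa) XM) (λ ()) }))
  ... | no sE≰M = inj₂ (empty-case X (λ a a≤n → ¬-not (λ Xa → let p , q = within a a≤n Xa in
    sE≰M (≤-trans (≤∧≢⇒< p (λ { refl → contradiction (trans (sym Xa) XE) (λ ()) }))
                  (≤-pred (≤∧≢⇒< q (λ { refl → contradiction (trans (sym Xa) XM) (λ ()) })))))))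

  good-or-improvable : ∀ X → Good n s e m X ⊎ Improvable X
  good-or-improvable X = good-or-improvable-within n 0 X (+-identityʳ n) z≤n (λ a a≤n _ → z≤n , a≤n)

  m+e : m + e ≡ n
  m+e = trans (+-comm m e) e+m

  m≤n : m ≤ n
  m≤n = subst (m ≤_) m+e (m≤m+n m e)

  Between-determined : ∀ {X Y} → Between n e m X → Between n e m Y → X e ≡ Y e → X m ≡ Y m →
    ∀ a → a ≤ n → X a ≡ Y a
  Between-determined {X} {Y} bX bY eq-e eq-m a a≤n with <-cmp e a | <-cmp a m
  ... | tri≈ _ refl _ | _             = eq-e
  ... | _             | tri≈ _ refl _ = eq-m
  ... | tri< e<a _ _  | tri< a<m _ _  = trans (Between.inner bX a e<a a<m) (sym (Between.inner bY a e<a a<m))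
  ... | tri> _ _ a<e  | _             =
    trans (¬-not (λ p → <⇒≱ a<e (proj₁ (Between.outer bX a a≤n p))))
          (sym (¬-not (λ p → <⇒≱ a<e (proj₁ (Between.outer bY a a≤n p)))))
  ... | _             | tri> _ _ m<a  =
    trans (¬-not (λ p → <⇒≱ m<a (proj₂ (Between.outer bX a a≤n p))))
          (sym (¬-not (λ p → <⇒≱ m<a (proj₂ (Between.outer bY a a≤n p)))))

  Between-update : ∀ {X} v → Between n e m X → Between n e m (update X m v)
  Between-update {X} v b = record
    { inner = λ a e<a a<m → trans (update-other X m v (<⇒≢ a<m)) (Between.inner b a e<a a<m)
    ; outer = outer }
    where
    outer : ∀ a → a ≤ n → update X m v a ≡ true → e ≤ a × a ≤ m
    outer a a≤n eq with a ≟ m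
    ... | yes refl = <⇒≤ e<m , ≤-refl
    ... | no _     = Between.outer b a a≤n eq

  centre : Stage → Pattern
  centre first  = interval (suc e) m
  centre second = interval e (suc m)

  centre-Between : ∀ t → Between n e m (centre t)
  centre-Between first = record
    { inner = λ a → interval-true
    ; outer = λ a _ eq → let p , q = interval-true⁻¹ eq in <⇒≤ p , <⇒≤ q }
  centre-Between second = record
    { inner = λ a e<a a<m → interval-true (<⇒≤ e<a) (m<n⇒m<1+n a<m)
    ; outer = λ a _ eq → let p , q = interval-true⁻¹ eq in p , ≤-pred q }

  -- The degree of `centre s` at level `m` is exactly `D`, so the penalty for missing sets and the
  -- chains they create cancel. This is the tie for which `D` was chosen.
  price-update-centre : ∀ v → price (update (centre s) m v) ≡ price (centre s)
  price-update-centre v = go v (centre s m) refl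
    where
    level-D : ∀ t → below (weight (centre t)) (suc r) m ≡ multiplier (suc r) t e m
    level-D first  = refl
    level-D second = below-cong (suc r) m (λ a a<m → ≤-antisym
      (weight-mono {interval e (suc m)} {interval e m} (λ eq → interval-true (proj₁ (interval-true⁻¹ eq)) a<m))
      (weight-mono {interval e m} {interval e (suc m)} (λ eq → let p , q = interval-true⁻¹ eq in interval-true p (m<n⇒m<1+n q))))
    degree-D : degree n (suc r) (centre s) m e ≡ D
    degree-D = trans (degree-top (suc r) (centre s) m e m+e
      (λ a m<a a≤n → ¬-not (λ p → <⇒≱ m<a (proj₂ (Between.outer (centre-Between s) a a≤n p))))) (level-D s)
    true≡false : price (update (centre s) m true) ≡ price (update (centre s) m false)
    true≡false = +-cancelʳ-≡ (binom m e * D) _ _ (trans (cost-toggle n (suc r) D (centre s) m e m+e)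
      (cong (λ t → price (update (centre s) m false) + binom m e * t) degree-D))
    unchanged : ∀ u → centre s m ≡ u → price (update (centre s) m u) ≡ price (centre s)
    unchanged u eq = cost-cong n (suc r) D (λ a _ → update-id (centre s) m u eq a)
    go : ∀ v u → centre s m ≡ u → price (update (centre s) m v) ≡ price (centre s)
    go true  true  eq = unchanged true eq
    go false false eq = unchanged false eq
    go true  false eq = trans true≡false (unchanged false eq)
    go false true  eq = trans (sym true≡false) (unchanged true eq)

  price-by-e : ∀ {X} → Good n s e m X → X e ≡ centre s e → price X ≡ price (centre s)
  price-by-e {X} g eq = trans
    (cost-cong n (suc r) D (Between-determined (Good.between g) (Between-update (X m) (centre-Between s))
      (trans eq (sym (update-other (centre s) m (X m) (<⇒≢ e<m)))) (sym (update-same (centre s) m (X m)))))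
    (price-update-centre (X m))

  -- A good pattern or its reverse agrees with the centre at level `e`; then it differs from it at
  -- most at level `m`, where changes are free.
  Good-price : ∀ {X} → Good n s e m X → price X ≡ price (centre s)
  Good-price {X} g = go s refl (X e) (X m) refl refl
    where
    direct : X e ≡ centre s e → price X ≡ price (centre s)
    direct = price-by-e g
    reversed : X m ≡ centre s e → price X ≡ price (centre s)
    reversed eq = trans (sym (cost-reverse n (suc r) D X))
      (price-by-e (Good-reverse e+m g) (trans (cong X (n∸e {s = s} e+m)) eq))
    low-first : s ≡ first → centre s e ≡ false
    low-first eq = trans (cong (λ t → centre t e) eq) (¬-not (λ p → <-irrefl refl (proj₁ (interval-true⁻¹ {suc e} {m} p))))
    low-second : s ≡ second → centre s e ≡ true
    low-second eq = trans (cong (λ t → centre t e) eq) (interval-true ≤-refl (m<n⇒m<1+n e<m))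
    go : ∀ t → s ≡ t → ∀ u v → X e ≡ u → X m ≡ v → price X ≡ price (centre s)
    go first  eq false v     Xe Xm = direct (trans Xe (sym (low-first eq)))
    go first  eq true  false Xe Xm = reversed (trans Xm (sym (low-first eq)))
    go first  eq true  true  Xe Xm = contradiction (Xe , Xm) (Good.outermost-first g eq)
    go second eq true  v     Xe Xm = direct (trans Xe (sym (low-second eq)))
    go second eq false true  Xe Xm = reversed (trans Xm (sym (low-second eq)))
    go second eq false false Xe Xm with Good.outermost-second g eq
    ... | inj₁ p = contradiction (trans (sym p) Xe) (λ ())
    ... | inj₂ p = contradiction (trans (sym p) Xm) (λ ())

  -- Prices are natural numbers, so repeated improvement stops, and it can stop only at a good
  -- pattern.
  centre-minimal : ∀ X → price (centre s) ≤ price X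
  centre-minimal X = go X (<-wellFounded (price X))
    where
    go : ∀ X → Acc _<_ (price X) → price (centre s) ≤ price X
    go X (acc rs) with good-or-improvable X
    ... | inj₁ g         = ≤-reflexive (sym (Good-price g))
    ... | inj₂ (X′ , lt) = ≤-trans (go X′ (rs lt)) (<⇒≤ lt)

  minimal-Good : ∀ X → price X ≤ price (centre s) → Good n s e m X
  minimal-Good X le with good-or-improvable X
  ... | inj₁ g         = g
  ... | inj₂ (X′ , lt) = contradiction (≤-trans le (centre-minimal X′)) (<⇒≱ lt)

-- Maximal chains

private variable
  A B : Set
  n k : ℕ

∑ : List A → (A → ℕ) → ℕ
∑ []       f = 0
∑ (x ∷ xs) f = f x + ∑ xs f

∑-cong : ∀ (xs : List A) {f g} → (∀ x → f x ≡ g x) → ∑ xs f ≡ ∑ xs g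
∑-cong []       h = refl
∑-cong (x ∷ xs) h = cong₂ _+_ (h x) (∑-cong xs h)

∑-*ˡ : ∀ (xs : List A) c f → ∑ xs (λ x → c * f x) ≡ c * ∑ xs f
∑-*ˡ []       c f = sym (*-zeroʳ c)
∑-*ˡ (x ∷ xs) c f = trans (cong (c * f x +_) (∑-*ˡ xs c f)) (sym (*-distribˡ-+ c (f x) _))

∑-++ : ∀ (xs ys : List A) f → ∑ (xs ++ ys) f ≡ ∑ xs f + ∑ ys f
∑-++ []       ys f = refl
∑-++ (x ∷ xs) ys f = trans (cong (f x +_) (∑-++ xs ys f)) (sym (+-assoc (f x) _ _))

∑-map : ∀ (h : A → B) xs f → ∑ (map h xs) f ≡ ∑ xs (λ x → f (h x))
∑-map h []       f = refl
∑-map h (x ∷ xs) f = cong (f (h x) +_) (∑-map h xs f)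

∑-concatMap : ∀ (h : A → List B) xs f → ∑ (concatMap h xs) f ≡ ∑ xs (λ x → ∑ (h x) f)
∑-concatMap h []       f = refl
∑-concatMap h (x ∷ xs) f = trans (∑-++ (h x) _ f) (cong (∑ (h x) f +_) (∑-concatMap h xs f))

length-filterᵇ : ∀ (p : A → Bool) xs → length (filterᵇ p xs) ≡ ∑ xs (λ x → 𝟙 (p x))
length-filterᵇ p []       = refl
length-filterᵇ p (x ∷ xs) with p x
... | true  = cong suc (length-filterᵇ p xs)
... | false = length-filterᵇ p xs

∑-antidiag : ∀ (xs : List A) m (f : A → ℕ → ℕ → ℕ) →
  ∑ xs (λ x → antidiag m (f x)) ≡ antidiag m (λ a b → ∑ xs (λ x → f x a b))
∑-antidiag []       m f = sym (antidiag-zero m)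
∑-antidiag (x ∷ xs) m f = trans (cong (antidiag m (f x) +_) (∑-antidiag xs m f)) (sym (antidiag-+ m (f x) _))

∑-tuples : ∀ n k (h : Vec (Subset n) (suc k) → ℕ) →
  ∑ (allTuples n (suc k)) h ≡ ∑ (allSubsets n) (λ A → ∑ (allTuples n k) (λ As → h (A ∷ As)))
∑-tuples n k h = trans (∑-concatMap (λ A → map (A ∷_) (allTuples n k)) (allSubsets n) h)
  (∑-cong (allSubsets n) (λ A → ∑-map (A ∷_) (allTuples n k) h))

same : Subset n → Subset n → ℕ
same []            []            = 1
same (true  ∷ A) (true  ∷ B) = same A B
same (false ∷ A) (false ∷ B) = same A B
same (true  ∷ A) (false ∷ B) = 0
same (false ∷ A) (true  ∷ B) = 0

same-refl : ∀ (A : Subset n) → same A A ≡ 1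
same-refl []          = refl
same-refl (true  ∷ A) = same-refl A
same-refl (false ∷ A) = same-refl A

same⇒≡ : ∀ (A B : Subset n) → 0 < same A B → A ≡ B
same⇒≡ []          []          _ = refl
same⇒≡ (true  ∷ A) (true  ∷ B) p = cong (true ∷_) (same⇒≡ A B p)
same⇒≡ (false ∷ A) (false ∷ B) p = cong (false ∷_) (same⇒≡ A B p)

same-≢ : ∀ (A B : Subset n) → A ≢ B → same A B ≡ 0
same-≢ A B ne = n≤0⇒n≡0 (≮⇒≥ (λ p → ne (same⇒≡ A B p)))

∑-same : ∀ n (A : Subset n) h → ∑ (allSubsets n) (λ B → same A B * h B) ≡ h A
∑-same zero    []      h = trans (+-identityʳ _) (+-identityʳ _)
∑-same (suc n) (x ∷ A) h = trans
  (∑-concatMap (λ B → (outside ∷ B) ∷ (inside ∷ B) ∷ []) (allSubsets n) _)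
  (trans (∑-cong (allSubsets n) (by-bit x)) (∑-same n A (λ B → h (x ∷ B))))
  where
  by-bit : ∀ x B → same (x ∷ A) (outside ∷ B) * h (outside ∷ B) + (same (x ∷ A) (inside ∷ B) * h (inside ∷ B) + 0) ≡
                   same A B * h (x ∷ B)
  by-bit true  B = +-identityʳ _
  by-bit false B = +-identityʳ _

coSize : Subset n → ℕ
coSize []          = 0
coSize (true  ∷ A) = coSize A
coSize (false ∷ A) = suc (coSize A)

size+coSize : ∀ (A : Subset n) → ∣ A ∣ + coSize A ≡ n
size+coSize []          = refl
size+coSize (true  ∷ A) = cong suc (size+coSize A)
size+coSize (false ∷ A) = trans (+-suc ∣ A ∣ (coSize A)) (cong suc (size+coSize A))

coSize-antitone : ∀ {A B : Subset n} → A ⊆ B → coSize B ≤ coSize A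
coSize-antitone {A = A} {B} A⊆B = +-cancelˡ-≤ ∣ A ∣ _ _ (≤-trans (+-monoˡ-≤ (coSize B) (p⊆q⇒∣p∣≤∣q∣ A⊆B))
  (≤-reflexive (trans (size+coSize B) (sym (size+coSize A)))))

coSize-⊥ : ∀ n → coSize (⊥ {n}) ≡ n
coSize-⊥ zero    = refl
coSize-⊥ (suc n) = cong suc (coSize-⊥ n)

-- f a is the a-th set of a maximal chain. A maximal chain on n + 1 points is obtained from one on
-- n points by choosing the last level p that avoids the new point.
insertAt : ℕ → (ℕ → Subset n) → ℕ → Subset (suc n)
insertAt p f a with a ≤? p
... | yes _ = outside ∷ f a
... | no _  = inside ∷ f (pred a)

data Flag : ∀ n → (ℕ → Subset n) → Set where
  trivial : Flag 0 (λ _ → [])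
  extend  : ∀ {n f} p q → p + q ≡ n → Flag n f → Flag (suc n) (insertAt p f)

-- Passing to `suc n` points offers `suc n` entry levels for the new point, so the sum runs over all
-- `n !` maximal chains on `n` points.
flagSum : ∀ n → ((ℕ → Subset n) → ℕ) → ℕ
flagSum zero    g = g (λ _ → [])
flagSum (suc n) g = antidiag n (λ p _ → flagSum n (λ f → g (insertAt p f)))

flagSum-cong : ∀ n {g h} → (∀ f → Flag n f → g f ≡ h f) → flagSum n g ≡ flagSum n h
flagSum-cong zero    e = e _ trivial
flagSum-cong (suc n) e = antidiag-cong n (λ p q pq → flagSum-cong n (λ f F → e _ (extend p q pq F)))

flagSum-mono : ∀ n {g h} → (∀ f → Flag n f → g f ≤ h f) → flagSum n g ≤ flagSum n h
flagSum-mono zero    e = e _ trivial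
flagSum-mono (suc n) e = antidiag-mono n (λ p q pq → flagSum-mono n (λ f F → e _ (extend p q pq F)))

flagSum-strict : ∀ {n f g h} → (∀ f → Flag n f → g f ≤ h f) → Flag n f → g f < h f → flagSum n g < flagSum n h
flagSum-strict e trivial lt = lt
flagSum-strict {suc n} e (extend p q pq F) lt = antidiag-strict n
  (λ p q pq → flagSum-mono n (λ f F → e _ (extend p q pq F))) p q pq
  (flagSum-strict (λ f F → e _ (extend p q pq F)) F lt)

flagSum-positive : ∀ n g → 0 < flagSum n g → ∃ λ f → Flag n f × 0 < g f
flagSum-positive zero    g pos = _ , trivial , pos
flagSum-positive (suc n) g pos with p , q , pq , pos′ ← antidiag-positive n _ pos
  with f , F , pos″ ← flagSum-positive n _ pos′ = _ , extend p q pq F , pos″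

flagSum-+ : ∀ n g h → flagSum n (λ f → g f + h f) ≡ flagSum n g + flagSum n h
flagSum-+ zero    g h = refl
flagSum-+ (suc n) g h = trans (antidiag-cong n (λ p _ _ → flagSum-+ n _ _)) (antidiag-+ n _ _)

flagSum-*ˡ : ∀ n c g → flagSum n (λ f → c * g f) ≡ c * flagSum n g
flagSum-*ˡ zero    c g = refl
flagSum-*ˡ (suc n) c g = trans (antidiag-cong n (λ p _ _ → flagSum-*ˡ n c _)) (antidiag-*ˡ n c _)

flagSum-zero : ∀ n → flagSum n (λ _ → 0) ≡ 0
flagSum-zero zero    = refl
flagSum-zero (suc n) = trans (antidiag-cong n (λ p _ _ → flagSum-zero n)) (antidiag-zero n)

flagSum-∑ : ∀ n (xs : List A) (g : (ℕ → Subset n) → A → ℕ) →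
  flagSum n (λ f → ∑ xs (g f)) ≡ ∑ xs (λ x → flagSum n (λ f → g f x))
flagSum-∑ n []       g = flagSum-zero n
flagSum-∑ n (x ∷ xs) g = trans (flagSum-+ n _ _) (cong (flagSum n (λ f → g f x) +_) (flagSum-∑ n xs g))

Flag-size : ∀ {n f} → Flag n f → ∀ a → a ≤ n → ∣ f a ∣ ≡ a
Flag-size trivial zero z≤n = refl
Flag-size (extend p q pq F) a a≤n with a ≤? p
... | yes a≤p = Flag-size F a (≤-trans a≤p (m+n≤o⇒m≤o p (≤-reflexive pq)))
Flag-size (extend p q pq F) zero    a≤n | no a≰p = contradiction z≤n a≰p
Flag-size (extend p q pq F) (suc a) a≤n | no a≰p = cong suc (Flag-size F a (≤-pred a≤n))

Flag-mono : ∀ {n f} → Flag n f → ∀ a b → a ≤ b → b ≤ n → f a ⊆ f b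
Flag-mono trivial a b a≤b b≤n = ⊆-refl
Flag-mono (extend p q pq F) a b a≤b b≤n with a ≤? p | b ≤? p
... | yes _   | yes b≤p = out⊆ (Flag-mono F a b a≤b (≤-trans b≤p (m+n≤o⇒m≤o p (≤-reflexive pq))))
... | yes a≤p | no b≰p  = out⊆ (Flag-mono F a (pred b) (≤-trans a≤p (pred-mono-≤ (≰⇒> b≰p))) (pred-mono-≤ b≤n))
... | no a≰p  | yes b≤p = contradiction (≤-trans a≤b b≤p) a≰p
... | no a≰p  | no b≰p  = s⊆s (Flag-mono F (pred a) (pred b) (pred-mono-≤ a≤b) (pred-mono-≤ b≤n))

-- Inclusions are weak because deleting a point, in the induction on `n`, can make consecutive sets
-- equal.
data Ascending {n : ℕ} : Subset n → Vec (Subset n) k → Set where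
  []  : ∀ {A} → Ascending A []
  _∷_ : ∀ {A B} {Bs : Vec (Subset n) k} → A ⊆ B → Ascending B Bs → Ascending A (B ∷ Bs)

passes : (ℕ → Subset n) → Vec (Subset n) k → ℕ
passes f []       = 1
passes f (A ∷ As) = same (f ∣ A ∣) A * passes f As

-- c is the co-size of the preceding set of the chain.
gapProduct : ℕ → Vec (Subset n) k → ℕ
gapProduct c []       = c !
gapProduct c (A ∷ As) = (c ∸ coSize A) ! * gapProduct (coSize A) As

-- From `c ≡ n` this is N_S: a chain with the sizes of `As` is chosen from its lowest set upwards,
-- by complements.
multinomial : ℕ → Vec (Subset n) k → ℕ
multinomial c []       = 1
multinomial c (A ∷ As) = binom (coSize A) (c ∸ coSize A) * multinomial (coSize A) As

multinomial-gapProduct : ∀ (A : Subset n) (As : Vec (Subset n) k) → Ascending A As →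
  multinomial (coSize A) As * gapProduct (coSize A) As ≡ coSize A !
multinomial-gapProduct A []       []          = +-identityʳ _
multinomial-gapProduct A (B ∷ Bs) (A⊆B ∷ asc) = begin
  binom (coSize B) g * multinomial (coSize B) Bs * (g ! * gapProduct (coSize B) Bs)
    ≡⟨ rearrange (binom (coSize B) g) (multinomial (coSize B) Bs) (g !) (gapProduct (coSize B) Bs) ⟩
  binom (coSize B) g * (multinomial (coSize B) Bs * gapProduct (coSize B) Bs * g !)
    ≡⟨ cong (λ t → binom (coSize B) g * (t * g !)) (multinomial-gapProduct B Bs asc) ⟩
  binom (coSize B) g * (coSize B ! * g !) ≡⟨ binom-! (coSize B) g ⟩
  (coSize B + g) ! ≡⟨ cong _! (m+[n∸m]≡n (coSize-antitone A⊆B)) ⟩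
  coSize A ! ∎
  where
  open ≡-Reasoning
  g : ℕ
  g = coSize A ∸ coSize B
  rearrange : ∀ b m x y → b * m * (x * y) ≡ b * (m * y * x)
  rearrange = solve-∀

leq : ℕ → ℕ → ℕ
leq zero    b       = 1
leq (suc a) zero    = 0
leq (suc a) (suc b) = leq a b

leq-≤ : ∀ {a b} → a ≤ b → leq a b ≡ 1
leq-≤ z≤n     = refl
leq-≤ (s≤s p) = leq-≤ p

leq-> : ∀ {a b} → b < a → leq a b ≡ 0
leq-> {suc a} {zero}  p       = refl
leq-> {suc a} {suc b} (s≤s p) = leq-> p

antidiag-leqˡ : ∀ {c′ c} φ → c′ ≤ c → antidiag c (λ q _ → leq q c′ * φ q) ≡ antidiag c′ (λ q _ → φ q)
antidiag-leqˡ {zero} {zero}  φ z≤n = +-identityʳ _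
antidiag-leqˡ {zero} {suc c} φ z≤n = trans (cong₂ _+_ (+-identityʳ (φ 0)) (antidiag-zero c)) (+-identityʳ _)
antidiag-leqˡ {suc c′} {suc c} φ (s≤s p) = cong₂ _+_ (+-identityʳ (φ 0)) (antidiag-leqˡ (λ q → φ (suc q)) p)

antidiag-leqʳ : ∀ {c′ c} → c′ ≤ c → antidiag c (λ q _ → leq c′ q) ≡ suc (c ∸ c′)
antidiag-leqʳ {zero} {zero}  z≤n = refl
antidiag-leqʳ {zero} {suc c} z≤n = cong suc (antidiag-leqʳ {zero} {c} z≤n)
antidiag-leqʳ {suc c′} {suc c} (s≤s p) = antidiag-leqʳ p

-- Whether a maximal chain can pass through the set if the new point enters with q levels of the old chain
-- above the entry.
compatible : Subset (suc n) → ℕ → ℕ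
compatible (false ∷ A) q = leq q (coSize A)
compatible (true  ∷ A) q = leq (coSize A) q

compatibles : Vec (Subset (suc n)) k → ℕ → ℕ
compatibles []       q = 1
compatibles (A ∷ As) q = compatible A q * compatibles As q

tails : Vec (Subset (suc n)) k → Vec (Subset n) k
tails = Vec.map Vec.tail

same-insertAt : ∀ p q f (A : Subset (suc n)) → p + q ≡ n →
  same (insertAt p f ∣ A ∣) A ≡ compatible A q * same (f ∣ Vec.tail A ∣) (Vec.tail A)
same-insertAt p q f (false ∷ A) eq with ∣ A ∣ ≤? p
... | yes a≤p rewrite leq-≤ {q} {coSize A} (+-cancelˡ-≤ p _ _
        (≤-trans (≤-reflexive (trans eq (sym (size+coSize A)))) (+-monoˡ-≤ (coSize A) a≤p))) = sym (+-identityʳ _)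
... | no a≰p rewrite leq-> {q} {coSize A} (+-cancelˡ-< p _ _
        (<-≤-trans (+-monoˡ-< (coSize A) (≰⇒> a≰p)) (≤-reflexive (trans (size+coSize A) (sym eq))))) = refl
same-insertAt p q f (true ∷ A) eq with suc ∣ A ∣ ≤? p
... | yes a<p rewrite leq-> {coSize A} {q} (+-cancelˡ-< ∣ A ∣ _ _
        (<-≤-trans (+-monoˡ-< q a<p) (≤-reflexive (trans eq (sym (size+coSize A)))))) = refl
... | no a≮p rewrite leq-≤ {coSize A} {q} (+-cancelˡ-≤ ∣ A ∣ _ _
        (≤-trans (≤-reflexive (trans (size+coSize A) (sym eq))) (+-monoˡ-≤ q (≤-pred (≰⇒> a≮p))))) = sym (+-identityʳ _)

passes-insertAt : ∀ p q f (As : Vec (Subset (suc n)) k) → p + q ≡ n →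
  passes (insertAt p f) As ≡ compatibles As q * passes f (tails As)
passes-insertAt p q f []       eq = refl
passes-insertAt p q f (A ∷ As) eq rewrite same-insertAt p q f A eq | passes-insertAt p q f As eq =
  rearrange (compatible A q) _ (compatibles As q) _
  where
  rearrange : ∀ a b c d → a * b * (c * d) ≡ a * c * (b * d)
  rearrange = solve-∀

inside-⊈-outside : ∀ {A B : Subset n} → ¬ (inside ∷ A ⊆ outside ∷ B)
inside-⊈-outside sub with sub {Fin.zero} here
... | ()

Ascending-tails : ∀ {x} {A : Subset n} {As : Vec (Subset (suc n)) k} → Ascending (x ∷ A) As → Ascending A (tails As)
Ascending-tails []                          = []
Ascending-tails (_∷_ {B = y ∷ B} A⊆B asc) = drop-∷-⊆ A⊆B ∷ Ascending-tails asc

-- Supersets of a set containing the new point contain it too, and having smaller co-size they only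
-- demand less of `q`.
compatibles-inside : ∀ {A : Subset n} {As : Vec (Subset (suc n)) k} → Ascending (inside ∷ A) As → ∀ q →
  leq (coSize A) q * compatibles As q ≡ leq (coSize A) q
compatibles-inside []                             q = *-identityʳ _
compatibles-inside (_∷_ {B = false ∷ B} A⊆B asc) q = ⊥-elim (inside-⊈-outside A⊆B)
compatibles-inside {A = A} (_∷_ {B = true ∷ B} {Bs} A⊆B asc) q
  rewrite compatibles-inside asc q with coSize A ≤? q
... | yes p rewrite leq-≤ (≤-trans (coSize-antitone (drop-∷-⊆ A⊆B)) p) = *-identityʳ _
... | no p rewrite leq-> {coSize A} {q} (≰⇒> p) = refl

gapProduct-inside : ∀ c {A : Subset n} {As : Vec (Subset (suc n)) k} → Ascending (inside ∷ A) As →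
  gapProduct c As ≡ gapProduct c (tails As)
gapProduct-inside c []                             = refl
gapProduct-inside c (_∷_ {B = false ∷ B} A⊆B asc) = ⊥-elim (inside-⊈-outside A⊆B)
gapProduct-inside c (_∷_ {B = true ∷ B} A⊆B asc)  = cong ((c ∸ coSize B) ! *_) (gapProduct-inside (coSize B) asc)

antidiag-one : ∀ c → antidiag c (λ _ _ → 1) ≡ suc c
antidiag-one zero    = refl
antidiag-one (suc c) = cong suc (antidiag-one c)

-- The new point enters between the last set avoiding it and the first containing it, or the full
-- set. If this gap is `g` without the new point, there are `g + 1` entries, which turns `g !` into
-- `(suc g) !`; all other gaps are unchanged.
gapProduct-outside : ∀ (A : Subset n) (As : Vec (Subset (suc n)) k) → Ascending (outside ∷ A) As →
  antidiag (coSize A) (λ q _ → compatibles As q) * gapProduct (coSize A) (tails As) ≡ gapProduct (suc (coSize A)) As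
gapProduct-outside A [] [] = cong (_* coSize A !) (antidiag-one (coSize A))
gapProduct-outside A ((false ∷ B) ∷ Bs) (A⊆B ∷ asc) = begin
  antidiag (coSize A) (λ q _ → leq q (coSize B) * compatibles Bs q) * (g ! * gapProduct (coSize B) (tails Bs))
    ≡⟨ cong (_* (g ! * gapProduct (coSize B) (tails Bs))) (antidiag-leqˡ (compatibles Bs) (coSize-antitone (drop-∷-⊆ A⊆B))) ⟩
  antidiag (coSize B) (λ q _ → compatibles Bs q) * (g ! * gapProduct (coSize B) (tails Bs))
    ≡⟨ rearrange (antidiag (coSize B) (λ q _ → compatibles Bs q)) (g !) (gapProduct (coSize B) (tails Bs)) ⟩
  g ! * (antidiag (coSize B) (λ q _ → compatibles Bs q) * gapProduct (coSize B) (tails Bs))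
    ≡⟨ cong (g ! *_) (gapProduct-outside B Bs asc) ⟩
  g ! * gapProduct (suc (coSize B)) Bs ∎
  where
  open ≡-Reasoning
  g : ℕ
  g = coSize A ∸ coSize B
  rearrange : ∀ x y z → x * (y * z) ≡ y * (x * z)
  rearrange = solve-∀
gapProduct-outside A ((true ∷ B) ∷ Bs) (A⊆B ∷ asc) = begin
  antidiag (coSize A) (λ q _ → leq (coSize B) q * compatibles Bs q) * (g ! * gapProduct (coSize B) (tails Bs))
    ≡⟨ cong (_* (g ! * gapProduct (coSize B) (tails Bs))) (trans
         (antidiag-cong (coSize A) (λ q _ _ → compatibles-inside asc q)) (antidiag-leqʳ B≤A)) ⟩
  suc g * (g ! * gapProduct (coSize B) (tails Bs)) ≡⟨ *-assoc (suc g) (g !) _ ⟨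
  (suc g) ! * gapProduct (coSize B) (tails Bs)
    ≡⟨ cong₂ (λ s t → s ! * t) (sym (+-∸-assoc 1 B≤A)) (sym (gapProduct-inside (coSize B) asc)) ⟩
  (suc (coSize A) ∸ coSize B) ! * gapProduct (coSize B) Bs ∎
  where
  open ≡-Reasoning
  g : ℕ
  g = coSize A ∸ coSize B
  B≤A : coSize B ≤ coSize A
  B≤A = coSize-antitone (drop-∷-⊆ A⊆B)

flagSum-passes : ∀ n (As : Vec (Subset n) k) → Ascending ⊥ As → flagSum n (λ f → passes f As) ≡ gapProduct n As
flagSum-passes zero As asc = trivial-passes As
  where
  trivial-passes : ∀ {k} (As : Vec (Subset 0) k) → passes (λ _ → []) As ≡ gapProduct 0 As
  trivial-passes []        = refl
  trivial-passes ([] ∷ As) = cong (_+ 0) (trivial-passes As)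
flagSum-passes (suc n) As asc = begin
  antidiag n (λ p _ → flagSum n (λ f → passes (insertAt p f) As))
    ≡⟨ antidiag-cong n (λ p q eq → trans (flagSum-cong n (λ f _ → passes-insertAt p q f As eq)) (flagSum-*ˡ n (compatibles As q) _)) ⟩
  antidiag n (λ p q → compatibles As q * flagSum n (λ f → passes f (tails As)))
    ≡⟨ antidiag-*ʳ n _ _ ⟩
  antidiag n (λ p q → compatibles As q) * flagSum n (λ f → passes f (tails As))
    ≡⟨ cong₂ _*_ (antidiag-flip n _) (flagSum-passes n (tails As) (Ascending-tails asc)) ⟩
  antidiag n (λ q _ → compatibles As q) * gapProduct n (tails As)
    ≡⟨ subst (λ c → antidiag c (λ q _ → compatibles As q) * gapProduct c (tails As) ≡ gapProduct (suc c) As)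
         (coSize-⊥ n) (gapProduct-outside ⊥ As asc) ⟩
  gapProduct (suc n) As ∎
  where open ≡-Reasoning

multinomial-flagSum : ∀ n (As : Vec (Subset n) k) → Ascending ⊥ As →
  multinomial n As * flagSum n (λ f → passes f As) ≡ n !
multinomial-flagSum n As asc = trans (cong (multinomial n As *_) (flagSum-passes n As asc))
  (subst (λ c → multinomial c As * gapProduct c As ≡ c !) (coSize-⊥ n) (multinomial-gapProduct ⊥ As asc))

coLevel : ∀ {A : Subset n} {a b} → ∣ A ∣ ≡ a → a + b ≡ n → coSize A ≡ b
coLevel {A = A} refl eq = +-cancelˡ-≡ ∣ A ∣ _ _ (trans (size+coSize A) (sym eq))

∑-levels : ∀ {f} → Flag n f → ∀ h → ∑ (allSubsets n) (λ B → same (f ∣ B ∣) B * h B) ≡ antidiag n (λ a _ → h (f a))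
∑-levels {n} {f} F h = begin
  ∑ (allSubsets n) (λ B → same (f ∣ B ∣) B * h B)
    ≡⟨ ∑-cong (allSubsets n) (λ B → sym (antidiag-single n (λ a _ → same (f a) B * h B) ∣ B ∣ (coSize B) (size+coSize B)
         (λ a c eq ne → cong (_* h B) (same-≢ (f a) B (λ fa≡B → ne (trans (sym (Flag-size F a (subst (a ≤_) eq (m≤m+n a c)))) (cong ∣_∣ fa≡B))))))) ⟩
  ∑ (allSubsets n) (λ B → antidiag n (λ a _ → same (f a) B * h B)) ≡⟨ ∑-antidiag (allSubsets n) n _ ⟩
  antidiag n (λ a _ → ∑ (allSubsets n) (λ B → same (f a) B * h B)) ≡⟨ antidiag-cong n (λ a _ _ → ∑-same n (f a) h) ⟩
  antidiag n (λ a _ → h (f a)) ∎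
  where open ≡-Reasoning

-- Chains of a family along one maximal chain

chainAbove : Family n → Subset n → Vec (Subset n) k → ℕ
chainAbove 𝒜 A []       = 1
chainAbove 𝒜 A (B ∷ Bs) = 𝟙 (does (A ⊂? B)) * (𝟙 (𝒜 B) * chainAbove 𝒜 B Bs)

𝟙-∧ : ∀ a b → 𝟙 (a ∧ b) ≡ 𝟙 a * 𝟙 b
𝟙-∧ true  b = sym (+-identityʳ (𝟙 b))
𝟙-∧ false b = refl

isChain-chainAbove : ∀ (𝒜 : Family n) A (As : Vec (Subset n) k) → 𝟙 (isChain 𝒜 (A ∷ As)) ≡ 𝟙 (𝒜 A) * chainAbove 𝒜 A As
isChain-chainAbove 𝒜 A []       = sym (*-identityʳ _)
isChain-chainAbove 𝒜 A (B ∷ Bs) = trans (𝟙-∧ (𝒜 A) _) (cong (𝟙 (𝒜 A) *_)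
  (trans (𝟙-∧ (does (A ⊂? B)) _) (cong (𝟙 (does (A ⊂? B)) *_) (isChain-chainAbove 𝒜 B Bs))))

trace : Family n → (ℕ → Subset n) → Pattern
trace 𝒜 f a = 𝒜 (f a)

Flag-⊂ : ∀ {f} → Flag n f → ∀ a b → a < b → b ≤ n → f a ⊂ f b
Flag-⊂ {f = f} F a b a<b b≤n with f a ⊂? f b
... | yes p = p
... | no ¬p = contradiction a<b (≤⇒≯ (subst₂ _≤_ (Flag-size F b b≤n) (Flag-size F a (≤-trans (<⇒≤ a<b) b≤n))
    (p⊆q⇒∣p∣≤∣q∣ (⊄⇒⊇ (Flag-mono F a b (<⇒≤ a<b) b≤n) ¬p))))
  where
  ⊄⇒⊇ : ∀ {n} {A B : Subset n} → A ⊆ B → ¬ (A ⊂ B) → B ⊆ A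
  ⊄⇒⊇ {A = A} A⊆B ¬p {x} x∈B with x ∈? A
  ... | yes x∈A = x∈A
  ... | no x∉A  = contradiction ((λ {x} → A⊆B {x}) , x , x∈B , x∉A) ¬p

module _ (𝒜 : Family n) {f : ℕ → Subset n} (F : Flag n f) where

  private
    y : ℕ → ℕ
    y = weight (reverse n (trace 𝒜 f))

    continuations : ℕ → ℕ → Subset n → ℕ
    continuations k c A = ∑ (allTuples n k) (λ As → chainAbove 𝒜 A As * (passes f As * multinomial c As))

    -- Read in co-levels, the recursion of `below` chooses the next set above `f a`, just as a tuple
    -- does. The factor `same` retains one set per level, and the binomials of `below` multiply to
    -- `multinomial`.
    below-continuations : ∀ r a c → a + c ≡ n → below y r c ≡ continuations r c (f a)
    below-continuations zero    a c eq = refl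
    below-continuations (suc r) a c eq = sym (begin
      ∑ (allTuples n (suc r)) (λ As → chainAbove 𝒜 (f a) As * (passes f As * multinomial c As))
        ≡⟨ ∑-tuples n r _ ⟩
      ∑ (allSubsets n) (λ B → ∑ (allTuples n r) (λ Bs → chainAbove 𝒜 (f a) (B ∷ Bs) * (passes f (B ∷ Bs) * multinomial c (B ∷ Bs))))
        ≡⟨ ∑-cong (allSubsets n) collect ⟩
      ∑ (allSubsets n) (λ B → same (f ∣ B ∣) B * H B) ≡⟨ ∑-levels F H ⟩
      antidiag n (λ a′ _ → H (f a′)) ≡⟨ antidiag-flip n _ ⟩
      antidiag n (λ _ a′ → H (f a′)) ≡⟨ cong (λ t → antidiag t (λ _ a′ → H (f a′))) (trans (sym eq) (+-comm a c)) ⟩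
      antidiag (c + a) (λ _ a′ → H (f a′)) ≡⟨ antidiag-split c a _ ⟩
      antidiag c (λ _ g → positive g * H (f (g + a))) + antidiag a (λ _ a′ → H (f a′))
        ≡⟨ cong₂ _+_ (antidiag-cong c up) (trans (antidiag-cong a down) (antidiag-zero a)) ⟩
      below y (suc r) c + 0 ≡⟨ +-identityʳ _ ⟩
      below y (suc r) c ∎)
      where
      open ≡-Reasoning
      H : Subset n → ℕ
      H B = 𝟙 (does (f a ⊂? B)) * (𝟙 (𝒜 B) * (binom (coSize B) (c ∸ coSize B) * continuations r (coSize B) B))
      rearrange : ∀ u v w p q s t → (u * (v * w)) * ((p * q) * (s * t)) ≡ (p * (u * (v * s))) * (w * (q * t))
      rearrange = solve-∀
      reassoc : ∀ p u v s C → (p * (u * (v * s))) * C ≡ p * (u * (v * (s * C)))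
      reassoc = solve-∀
      collect : ∀ B → ∑ (allTuples n r) (λ Bs → chainAbove 𝒜 (f a) (B ∷ Bs) * (passes f (B ∷ Bs) * multinomial c (B ∷ Bs))) ≡
                      same (f ∣ B ∣) B * H B
      collect B = begin
        ∑ (allTuples n r) (λ Bs → chainAbove 𝒜 (f a) (B ∷ Bs) * (passes f (B ∷ Bs) * multinomial c (B ∷ Bs)))
          ≡⟨ ∑-cong (allTuples n r) (λ Bs → rearrange (𝟙 (does (f a ⊂? B))) (𝟙 (𝒜 B)) (chainAbove 𝒜 B Bs)
               (same (f ∣ B ∣) B) (passes f Bs) (binom (coSize B) (c ∸ coSize B)) (multinomial (coSize B) Bs)) ⟩
        ∑ (allTuples n r) (λ Bs → (same (f ∣ B ∣) B * (𝟙 (does (f a ⊂? B)) * (𝟙 (𝒜 B) * binom (coSize B) (c ∸ coSize B)))) *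
                                   (chainAbove 𝒜 B Bs * (passes f Bs * multinomial (coSize B) Bs)))
          ≡⟨ ∑-*ˡ (allTuples n r) (same (f ∣ B ∣) B * (𝟙 (does (f a ⊂? B)) * (𝟙 (𝒜 B) * binom (coSize B) (c ∸ coSize B)))) _ ⟩
        (same (f ∣ B ∣) B * (𝟙 (does (f a ⊂? B)) * (𝟙 (𝒜 B) * binom (coSize B) (c ∸ coSize B)))) * continuations r (coSize B) B
          ≡⟨ reassoc (same (f ∣ B ∣) B) (𝟙 (does (f a ⊂? B))) (𝟙 (𝒜 B)) (binom (coSize B) (c ∸ coSize B)) (continuations r (coSize B) B) ⟩
        same (f ∣ B ∣) B * H B ∎
      down : ∀ b a′ → b + a′ ≡ a → H (f a′) ≡ 0
      down b a′ e = cong (λ t → 𝟙 t * (𝟙 (𝒜 (f a′)) * (binom (coSize (f a′)) (c ∸ coSize (f a′)) * continuations r (coSize (f a′)) (f a′))))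
        (dec-false (f a ⊂? f a′) (λ p → <⇒≱ (p⊂q⇒∣p∣<∣q∣ p)
          (subst₂ _≤_ (sym (Flag-size F a′ (≤-trans a′≤a a≤n))) (sym (Flag-size F a a≤n)) a′≤a)))
        where
        a≤n : a ≤ n
        a≤n = subst (a ≤_) eq (m≤m+n a c)
        a′≤a : a′ ≤ a
        a′≤a = subst (a′ ≤_) e (m≤n+m a′ b)
      up : ∀ d g → d + g ≡ c → positive g * H (f (g + a)) ≡ positive g * (y d * (binom d g * below y r d))
      up d zero    e = refl
      up d (suc g) e = cong (1 *_) (begin
        H (f (suc g + a))
          ≡⟨ cong (λ t → 𝟙 t * rest) (dec-true (f a ⊂? f (suc g + a)) (Flag-⊂ F a (suc g + a) (s≤s (m≤n+m a g)) ga≤n)) ⟩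
        1 * rest ≡⟨ +-identityʳ _ ⟩
        rest ≡⟨ cong (λ t → 𝟙 (𝒜 (f (suc g + a))) * (binom t (c ∸ t) * continuations r t (f (suc g + a)))) co ⟩
        𝟙 (𝒜 (f (suc g + a))) * (binom d (c ∸ d) * continuations r d (f (suc g + a)))
          ≡⟨ cong₂ (λ s t → s * (binom d t * continuations r d (f (suc g + a))))
               (sym (cong 𝟙 (reverse-apply (trace 𝒜 f) (suc g + a) d level))) (trans (cong (_∸ d) (sym e)) (m+n∸m≡n d (suc g))) ⟩
        y d * (binom d (suc g) * continuations r d (f (suc g + a)))
          ≡⟨ cong (λ t → y d * (binom d (suc g) * t)) (below-continuations r (suc g + a) d level) ⟨
        y d * (binom d (suc g) * below y r d) ∎)
        where
        shuffle : ∀ g a d → g + a + d ≡ a + (d + g)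
        shuffle = solve-∀
        level : suc g + a + d ≡ n
        level = trans (shuffle (suc g) a d) (trans (cong (a +_) e) eq)
        ga≤n : suc g + a ≤ n
        ga≤n = subst (suc g + a ≤_) level (m≤m+n _ d)
        co : coSize (f (suc g + a)) ≡ d
        co = coLevel {A = f (suc g + a)} (Flag-size F (suc g + a) ga≤n) level
        rest : ℕ
        rest = 𝟙 (𝒜 (f (suc g + a))) * (binom (coSize (f (suc g + a))) (c ∸ coSize (f (suc g + a))) *
                 continuations r (coSize (f (suc g + a))) (f (suc g + a)))

  -- Each choice of levels from the trace is realised by exactly one chain of the family on the
  -- flag, and `multinomial` counts all chains on these levels.
  chainSum-trace : ∀ r → chainSum n r (weight (trace 𝒜 f)) ≡
    ∑ (allTuples n (suc r)) (λ As → 𝟙 (isChain 𝒜 As) * (passes f As * multinomial n As))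
  chainSum-trace r = begin
    chainSum n r (weight (trace 𝒜 f))
      ≡⟨ chainSum-reverse n r _ y (λ a b eq → cong 𝟙 (sym (reverse-apply (trace 𝒜 f) a b eq))) ⟩
    antidiag n (λ b a → binom b a * (y b * below y r b)) ≡⟨ antidiag-flip n _ ⟩
    antidiag n (λ a b → binom b a * (y b * below y r b)) ≡⟨ antidiag-cong n level ⟩
    antidiag n (λ a _ → H (f a)) ≡⟨ ∑-levels F H ⟨
    ∑ (allSubsets n) (λ A → same (f ∣ A ∣) A * H A) ≡⟨ ∑-cong (allSubsets n) collect ⟨
    ∑ (allSubsets n) (λ A → ∑ (allTuples n r) (λ As → 𝟙 (isChain 𝒜 (A ∷ As)) * (passes f (A ∷ As) * multinomial n (A ∷ As))))
      ≡⟨ ∑-tuples n r _ ⟨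
    ∑ (allTuples n (suc r)) (λ As → 𝟙 (isChain 𝒜 As) * (passes f As * multinomial n As)) ∎
    where
    open ≡-Reasoning
    H : Subset n → ℕ
    H A = binom (coSize A) (n ∸ coSize A) * (𝟙 (𝒜 A) * continuations r (coSize A) A)
    level : ∀ a b → a + b ≡ n → binom b a * (y b * below y r b) ≡ H (f a)
    level a b eq rewrite coLevel {A = f a} (Flag-size F a (subst (a ≤_) eq (m≤m+n a b))) eq
                       | below-continuations r a b eq | reverse-apply (trace 𝒜 f) a b eq =
      cong (λ t → binom b t * (𝟙 (𝒜 (f a)) * continuations r b (f a))) (sym (trans (cong (_∸ b) (sym eq)) (m+n∸n≡m a b)))
    rearrange : ∀ v w p q s t → (v * w) * ((p * q) * (s * t)) ≡ (p * (s * v)) * (w * (q * t))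
    rearrange = solve-∀
    reassoc : ∀ p s v C → (p * (s * v)) * C ≡ p * (s * (v * C))
    reassoc = solve-∀
    collect : ∀ A → ∑ (allTuples n r) (λ As → 𝟙 (isChain 𝒜 (A ∷ As)) * (passes f (A ∷ As) * multinomial n (A ∷ As))) ≡
                    same (f ∣ A ∣) A * H A
    collect A = begin
      ∑ (allTuples n r) (λ As → 𝟙 (isChain 𝒜 (A ∷ As)) * (passes f (A ∷ As) * multinomial n (A ∷ As)))
        ≡⟨ ∑-cong (allTuples n r) (λ As → trans (cong (_* (passes f (A ∷ As) * multinomial n (A ∷ As))) (isChain-chainAbove 𝒜 A As))
             (rearrange (𝟙 (𝒜 A)) (chainAbove 𝒜 A As) (same (f ∣ A ∣) A) (passes f As) (binom (coSize A) (n ∸ coSize A)) (multinomial (coSize A) As))) ⟩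
      ∑ (allTuples n r) (λ As → (same (f ∣ A ∣) A * (binom (coSize A) (n ∸ coSize A) * 𝟙 (𝒜 A))) *
                                 (chainAbove 𝒜 A As * (passes f As * multinomial (coSize A) As)))
        ≡⟨ ∑-*ˡ (allTuples n r) (same (f ∣ A ∣) A * (binom (coSize A) (n ∸ coSize A) * 𝟙 (𝒜 A))) _ ⟩
      (same (f ∣ A ∣) A * (binom (coSize A) (n ∸ coSize A) * 𝟙 (𝒜 A))) * continuations r (coSize A) A
        ≡⟨ reassoc (same (f ∣ A ∣) A) (binom (coSize A) (n ∸ coSize A)) (𝟙 (𝒜 A)) (continuations r (coSize A) A) ⟩
      same (f ∣ A ∣) A * H A ∎

isChain-∷ : ∀ (𝒜 : Family n) A B (As : Vec (Subset n) k) → isChain 𝒜 (A ∷ B ∷ As) ≡ true →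
  𝒜 A ≡ true × A ⊂ B × isChain 𝒜 (B ∷ As) ≡ true
isChain-∷ 𝒜 A B As eq with 𝒜 A | A ⊂? B
... | true | yes A⊂B = refl , A⊂B , eq

isChain-head : ∀ (𝒜 : Family n) A (As : Vec (Subset n) k) → isChain 𝒜 (A ∷ As) ≡ true → 𝒜 A ≡ true
isChain-head 𝒜 A []       eq = eq
isChain-head 𝒜 A (B ∷ As) eq = proj₁ (isChain-∷ 𝒜 A B As eq)

isChain-Ascending : ∀ (𝒜 : Family n) A (As : Vec (Subset n) k) → isChain 𝒜 (A ∷ As) ≡ true → Ascending A As
isChain-Ascending 𝒜 A []       eq = []
isChain-Ascending 𝒜 A (B ∷ As) eq = let _ , A⊂B , eq′ = isChain-∷ 𝒜 A B As eq in
  proj₁ A⊂B ∷ isChain-Ascending 𝒜 B As eq′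

-- A chain of the family contributes `multinomial` on each maximal chain through it; by
-- `multinomial-flagSum` these contributions add up to `n !`, whatever its levels.
flagSum-chains : ∀ (𝒜 : Family n) r → flagSum n (λ f → chainSum n r (weight (trace 𝒜 f))) ≡ n ! * chains (suc r) 𝒜
flagSum-chains {n} 𝒜 r = begin
  flagSum n (λ f → chainSum n r (weight (trace 𝒜 f))) ≡⟨ flagSum-cong n (λ f F → chainSum-trace 𝒜 F r) ⟩
  flagSum n (λ f → ∑ (allTuples n (suc r)) (λ As → 𝟙 (isChain 𝒜 As) * (passes f As * multinomial n As)))
    ≡⟨ flagSum-∑ n (allTuples n (suc r)) _ ⟩
  ∑ (allTuples n (suc r)) (λ As → flagSum n (λ f → 𝟙 (isChain 𝒜 As) * (passes f As * multinomial n As)))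
    ≡⟨ ∑-cong (allTuples n (suc r)) per-chain ⟩
  ∑ (allTuples n (suc r)) (λ As → n ! * 𝟙 (isChain 𝒜 As)) ≡⟨ ∑-*ˡ (allTuples n (suc r)) (n !) _ ⟩
  n ! * ∑ (allTuples n (suc r)) (λ As → 𝟙 (isChain 𝒜 As)) ≡⟨ cong (n ! *_) (length-filterᵇ (isChain 𝒜) (allTuples n (suc r))) ⟨
  n ! * chains (suc r) 𝒜 ∎
  where
  open ≡-Reasoning
  per-chain : ∀ As → flagSum n (λ f → 𝟙 (isChain 𝒜 As) * (passes f As * multinomial n As)) ≡ n ! * 𝟙 (isChain 𝒜 As)
  per-chain (A ∷ As) with isChain 𝒜 (A ∷ As) in eq
  ... | false = trans (flagSum-zero n) (sym (*-zeroʳ (n !)))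
  ... | true  = trans (flagSum-cong n (λ f _ → trans (+-identityʳ _) (*-comm (passes f (A ∷ As)) _)))
    (trans (flagSum-*ˡ n (multinomial n (A ∷ As)) _)
      (trans (multinomial-flagSum n (A ∷ As) (⊆-min A ∷ isChain-Ascending 𝒜 A As eq)) (sym (*-identityʳ (n !)))))

chains-one : ∀ (𝒜 : Family n) → chains 1 𝒜 ≡ size 𝒜
chains-one {n} 𝒜 = begin
  chains 1 𝒜 ≡⟨ length-filterᵇ (isChain 𝒜) (allTuples n 1) ⟩
  ∑ (allTuples n 1) (λ As → 𝟙 (isChain 𝒜 As)) ≡⟨ ∑-tuples n 0 _ ⟩
  ∑ (allSubsets n) (λ A → 𝟙 (𝒜 A) + 0) ≡⟨ ∑-cong (allSubsets n) (λ A → +-identityʳ _) ⟩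
  ∑ (allSubsets n) (λ A → 𝟙 (𝒜 A)) ≡⟨ length-filterᵇ 𝒜 (allSubsets n) ⟨
  size 𝒜 ∎
  where open ≡-Reasoning

complement : Family n → Family n
complement 𝒜 A = not (𝒜 A)

size-complement : ∀ (𝒜 ℬ : Family n) → size 𝒜 ≡ size ℬ → size (complement 𝒜) ≡ size (complement ℬ)
size-complement {n} 𝒜 ℬ eq = +-cancelˡ-≡ (size 𝒜) _ _
  (trans (total 𝒜 (allSubsets n)) (trans (sym (total ℬ (allSubsets n))) (cong (_+ size (complement ℬ)) (sym eq))))
  where
  total : ∀ (𝒜 : Family n) As → length (filterᵇ 𝒜 As) + length (filterᵇ (complement 𝒜) As) ≡ length As
  total 𝒜 []       = refl
  total 𝒜 (A ∷ As) with 𝒜 A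
  ... | true  = cong suc (total 𝒜 As)
  ... | false = trans (+-suc _ _) (cong suc (total 𝒜 As))

flagSum-cost : ∀ (𝒜 : Family n) r D → flagSum n (λ f → cost n r D (trace 𝒜 f)) ≡
  n ! * chains (suc r) 𝒜 + D * (n ! * size (complement 𝒜))
flagSum-cost {n} 𝒜 r D = trans (flagSum-+ n _ _) (cong₂ _+_ (flagSum-chains 𝒜 r)
  (trans (flagSum-*ˡ n D _) (cong (D *_) (begin
    flagSum n (λ f → antidiag n (λ a b → binom a b * 𝟙 (not (𝒜 (f a)))))
      ≡⟨ flagSum-cong n (λ f _ → antidiag-cong n (λ a b _ → cong (binom a b *_) (sym (*-identityʳ _)))) ⟩
    -- Missing sets are the chains of one set in the complementary family.
    flagSum n (λ f → chainSum n 0 (weight (trace (complement 𝒜) f))) ≡⟨ flagSum-chains (complement 𝒜) 0 ⟩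
    n ! * chains 1 (complement 𝒜) ≡⟨ cong (n ! *_) (chains-one (complement 𝒜)) ⟩
    n ! * size (complement 𝒜) ∎))))
  where open ≡-Reasoning

-- By counting: the number of maximal chains through `As` is a factor of `n !`, hence nonzero.
flag-through : ∀ (As : Vec (Subset n) k) → Ascending ⊥ As → ∃ λ f → Flag n f × 0 < passes f As
flag-through {n} As asc = flagSum-positive n _ (≢0⇒>0 (λ z → <⇒≢ (1≤n! n) (sym (trans (sym (multinomial-flagSum n As asc))
    (trans (cong (multinomial n As *_) z) (*-zeroʳ (multinomial n As)))))))
  where
  ≢0⇒>0 : ∀ {m} → m ≢ 0 → 0 < m
  ≢0⇒>0 {zero}  ne = contradiction refl ne
  ≢0⇒>0 {suc m} _  = z<s

*-positive : ∀ a b → 0 < a * b → 0 < a × 0 < b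
*-positive (suc a) (suc b) _ = z<s , z<s
*-positive (suc a) zero    p = contradiction (subst (0 <_) (*-zeroʳ a) p) (λ ())

flag-through-set : ∀ (A : Subset n) → ∃ λ f → Flag n f × f ∣ A ∣ ≡ A
flag-through-set A with f , F , p ← flag-through (A ∷ []) (⊆-min A ∷ []) =
  f , F , same⇒≡ _ _ (proj₁ (*-positive _ _ p))

flag-through-pair : ∀ (A B : Subset n) → A ⊆ B → ∃ λ f → Flag n f × f ∣ A ∣ ≡ A × f ∣ B ∣ ≡ B
flag-through-pair A B A⊆B with f , F , p ← flag-through (A ∷ B ∷ []) (⊆-min A ∷ (A⊆B ∷ [])) =
  f , F , same⇒≡ _ _ (proj₁ (*-positive _ _ p)) , same⇒≡ _ _ (proj₁ (*-positive _ _ (proj₂ (*-positive (same (f ∣ A ∣) A) _ p))))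

-- Centred families

-- |2|A| - n| = 2 reach A - n, so reach orders the sets by their distance from the middle.
reach : Subset n → ℕ
reach A = ∣ A ∣ ⊔ coSize A

distance-reach : ∀ a c → ∣ 2 * a - (a + c) ∣ + (a + c) ≡ 2 * (a ⊔ c)
distance-reach a c with ≤-total a c
... | inj₁ a≤c with t , refl ← m≤n⇒∃[o]m+o≡n a≤c = begin
  ∣ 2 * a - (a + (a + t)) ∣ + (a + (a + t)) ≡⟨ cong (λ z → ∣ 2 * a - z ∣ + (a + (a + t))) (l₁ a t) ⟩
  ∣ 2 * a - 2 * a + t ∣ + (a + (a + t))     ≡⟨ cong (_+ (a + (a + t))) (∣m-m+n∣≡n (2 * a) t) ⟩
  t + (a + (a + t))                         ≡⟨ l₂ a t ⟩
  2 * (a + t)                               ≡⟨ cong (2 *_) (m≤n⇒m⊔n≡n (m≤m+n a t)) ⟨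
  2 * (a ⊔ (a + t))                         ∎
  where
  open ≡-Reasoning
  l₁ : ∀ a t → a + (a + t) ≡ 2 * a + t
  l₁ = solve-∀
  l₂ : ∀ a t → t + (a + (a + t)) ≡ 2 * (a + t)
  l₂ = solve-∀
distance-reach a c | inj₂ c≤a with t , refl ← m≤n⇒∃[o]m+o≡n c≤a = begin
  ∣ 2 * (c + t) - (c + t + c) ∣ + (c + t + c) ≡⟨ cong (λ z → ∣ z - (c + t + c) ∣ + (c + t + c)) (l₁ c t) ⟩
  ∣ c + t + c + t - (c + t + c) ∣ + (c + t + c) ≡⟨ cong (_+ (c + t + c)) (∣m+n-m∣≡n (c + t + c) t) ⟩
  t + (c + t + c)                           ≡⟨ l₂ c t ⟩
  2 * (c + t)                               ≡⟨ cong (2 *_) (m≥n⇒m⊔n≡m (m≤m+n c t)) ⟨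
  2 * ((c + t) ⊔ c)                         ∎
  where
  open ≡-Reasoning
  ∣m+n-m∣≡n : ∀ m n → ∣ m + n - m ∣ ≡ n
  ∣m+n-m∣≡n m n = trans (∣-∣-comm (m + n) m) (∣m-m+n∣≡n m n)
  l₁ : ∀ c t → 2 * (c + t) ≡ c + t + c + t
  l₁ = solve-∀
  l₂ : ∀ c t → t + (c + t + c) ≡ 2 * (c + t)
  l₂ = solve-∀

distance-reach-set : ∀ (A : Subset n) → ∣ 2 * ∣ A ∣ - n ∣ + n ≡ 2 * reach A
distance-reach-set A = subst (λ m → ∣ 2 * ∣ A ∣ - m ∣ + m ≡ 2 * reach A) (size+coSize A) (distance-reach ∣ A ∣ (coSize A))

closer⇒reach : ∀ (B A : Subset n) → closerToMiddle B A → reach B < reach A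
closer⇒reach {n} B A c = *-cancelˡ-< 2 _ _ (subst₂ _<_ (distance-reach-set B) (distance-reach-set A) (+-monoˡ-< n c))

reach⇒closer : ∀ (B A : Subset n) → reach B < reach A → closerToMiddle B A
reach⇒closer {n} B A lt = +-cancelʳ-< n _ _
  (subst₂ _<_ (sym (distance-reach-set B)) (sym (distance-reach-set A)) (*-monoʳ-< 2 lt))

module _ (e m : ℕ) (e+m : e + m ≡ n) where

  reach≤⇒ : ∀ (A : Subset n) → reach A ≤ m → e ≤ ∣ A ∣ × ∣ A ∣ ≤ m
  reach≤⇒ A le = +-cancelʳ-≤ m e ∣ A ∣ (≤-trans (≤-reflexive (trans e+m (sym (size+coSize A))))
      (+-monoʳ-≤ ∣ A ∣ (≤-trans (m≤n⊔m ∣ A ∣ _) le))) , ≤-trans (m≤m⊔n ∣ A ∣ _) le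

  reach<⇒ : ∀ (A : Subset n) → reach A < m → e < ∣ A ∣ × ∣ A ∣ < m
  reach<⇒ A lt = +-cancelʳ-< m e ∣ A ∣ (≤-<-trans (≤-reflexive (trans e+m (sym (size+coSize A))))
      (+-monoʳ-< ∣ A ∣ (≤-<-trans (m≤n⊔m ∣ A ∣ _) lt))) , ≤-<-trans (m≤m⊔n ∣ A ∣ _) lt

  ⇒reach≤ : ∀ (A : Subset n) → e ≤ ∣ A ∣ → ∣ A ∣ ≤ m → reach A ≤ m
  ⇒reach≤ A e≤ ≤m = ⊔-lub ≤m (+-cancelˡ-≤ ∣ A ∣ _ _
    (≤-trans (≤-reflexive (trans (size+coSize A) (sym e+m))) (+-monoˡ-≤ m e≤)))

  ⇒reach< : ∀ (A : Subset n) → e < ∣ A ∣ → ∣ A ∣ < m → reach A < m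
  ⇒reach< A e< <m = ⊔-pres-<m <m (+-cancelˡ-< ∣ A ∣ _ _
    (≤-<-trans (≤-reflexive (trans (size+coSize A) (sym e+m))) (+-monoˡ-< m e<)))

farthest : ∀ (𝒜 : Family n) → ∃ (_∈F 𝒜) → ∃ λ A → A ∈F 𝒜 × (∀ B → B ∈F 𝒜 → reach B ≤ reach A)
farthest {n} 𝒜 (A₀ , A₀∈) = go n (λ B _ → ⊔-lub (∣p∣≤n B) (m+n≤o⇒n≤o ∣ B ∣ (≤-reflexive (size+coSize B))))
  where
  go : ∀ t → (∀ B → B ∈F 𝒜 → reach B ≤ t) → ∃ λ A → A ∈F 𝒜 × (∀ B → B ∈F 𝒜 → reach B ≤ reach A)
  go t bound with anySubset? (λ A → (𝒜 A Bool.≟ true) ×-dec (reach A ≟ t))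
  go t bound | yes (A , A∈ , refl) = A , A∈ , bound
  go zero bound | no none = contradiction (A₀ , A₀∈ , n≤0⇒n≡0 (bound A₀ A₀∈)) none
  go (suc t) bound | no none = go t (λ B B∈ → ≤-pred (≤∧≢⇒< (bound B B∈) (λ eq → none (B , B∈ , eq))))

∑-positive : ∀ {A : Set} (xs : List A) f → 0 < ∑ xs f → ∃ λ x → 0 < f x
∑-positive (x ∷ xs) f p with f x in eq
... | zero  = ∑-positive xs f p
... | suc _ = x , subst (0 <_) (sym eq) z<s

chain-pair : ∀ (𝒜 : Family n) r → 0 < chains (2 + r) 𝒜 → ∃₂ λ A B → A ∈F 𝒜 × B ∈F 𝒜 × A ⊂ B
chain-pair {n} 𝒜 r pos with ∑-positive (allTuples n (2 + r)) (λ As → 𝟙 (isChain 𝒜 As)) (subst (0 <_) (length-filterᵇ (isChain 𝒜) (allTuples n (2 + r))) pos)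
... | A ∷ B ∷ As , p with isChain 𝒜 (A ∷ B ∷ As) in eq
...   | true = let A∈ , A⊂B , eq′ = isChain-∷ 𝒜 A B As eq in A , B , A∈ , isChain-head 𝒜 B As eq′ , A⊂B

pair? : ∀ (P : Subset n → Bool) e m → Dec (∃₂ λ A B → ∣ A ∣ ≡ e × ∣ B ∣ ≡ m × P A ≡ true × P B ≡ true × A ⊂ B)
pair? P e m = anySubset? (λ A → anySubset? (λ B → (∣ A ∣ ≟ e) ×-dec ((∣ B ∣ ≟ m) ×-dec
  ((P A Bool.≟ true) ×-dec ((P B Bool.≟ true) ×-dec (A ⊂? B))))))

not-true⁻¹ : ∀ {b} → not b ≡ true → ¬ (b ≡ true)
not-true⁻¹ {true} ()
not-true⁻¹ {false} _ ()

-- Centredness along maximal chains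

AllGood : Family n → Stage → ℕ → ℕ → Set
AllGood {n} 𝒜 s e m = ∀ f → Flag n f → Good n s e m (trace 𝒜 f)

record Profile (𝒜 : Family n) (r : ℕ) : Set where
  field
    s                   : Stage
    e m                 : ℕ
    e+m                 : e + m ≡ n
    e<m                 : e < m
    allGood             : AllGood 𝒜 s e m
    multiplier-positive : 0 < multiplier (suc r) s e m

weight-positive : ∀ X a → 0 < weight X a → X a ≡ true
weight-positive X a p with X a
... | true = refl

-- The top set of a chain has level at most `m`, and the `r + 1` sets under it are of the kind that
-- the multiplier counts. In stage `first` this requires level `e` to be absent, which holds for `X`
-- or its reverse.
multiplier>0 : ∀ {r s e m X} → e + m ≡ n → e < m → Good n s e m X → 0 < chainSum n (suc r) (weight X) →
  0 < multiplier (suc r) s e m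
multiplier>0 {n} {r} {s} {e} {m} {X} e+m e<m g pos = by-stage s refl (X e) refl
  where
  m≤n : m ≤ n
  m≤n = subst (m ≤_) e+m (m≤n+m m e)
  bound : ∀ {Y} → Good n s e m Y → 0 < chainSum n (suc r) (weight Y) →
    (∀ a → a < m → e ≤ a → Y a ≡ true → stageLow s e ≤ a) → 0 < multiplier (suc r) s e m
  bound {Y} gY pY low with antidiag-positive n _ pY
  ... | a , b , eq , q with *-positive (weight Y a) _ (proj₂ (*-positive (binom a b) _ q))
  ...   | 0<Y , 0<below = <-≤-trans 0<below (≤-trans
          (below-mono-level (weight Y) (suc r) (proj₂ (Good.outer gY a a≤n (weight-positive Y a 0<Y))))
          (below-mono-weight (suc r) m (λ c c<m → weight-mono {Y} {interval (stageLow s e) m} (λ Yc →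
            interval-true (low c c<m (proj₁ (Good.outer gY c (≤-trans (<⇒≤ c<m) m≤n) Yc)) Yc) c<m))))
    where
    a≤n : a ≤ n
    a≤n = subst (a ≤_) eq (m≤m+n a b)
  above-e : ∀ {Y} → s ≡ first → Y e ≡ false → ∀ a → a < m → e ≤ a → Y a ≡ true → stageLow s e ≤ a
  above-e refl Ye a _ e≤a Ya = ≤∧≢⇒< e≤a (λ { refl → contradiction (trans (sym Ya) Ye) (λ ()) })
  by-stage : ∀ t → s ≡ t → ∀ v → X e ≡ v → 0 < multiplier (suc r) s e m
  by-stage second refl v Xe = bound g pos (λ a _ e≤a _ → e≤a)
  by-stage first  eq false Xe = bound g pos (above-e {X} eq Xe)
  by-stage first  eq true  Xe = bound (Good-reverse e+m g)
    (subst (0 <_) (chainSum-reverse n (suc r) _ _ (λ a b ab → cong 𝟙 (sym (reverse-apply X a b ab)))) pos)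
    (above-e {reverse n X} eq (trans (cong X (n∸e {s = s} e+m)) (¬-not (λ Xm → Good.outermost-first g eq (Xe , Xm)))))

Centred⇒Profile : ∀ (𝒜 : Family n) r → Centred 𝒜 → 0 < chains (2 + r) 𝒜 → Profile 𝒜 r
Centred⇒Profile {n} 𝒜 r centred pos with chain-pair 𝒜 r pos
... | P , Q , P∈ , Q∈ , P⊂Q with farthest 𝒜 (P , P∈)
...   | A , A∈ , A-farthest = profile
  where
  e m : ℕ
  e = ∣ A ∣ ⊓ coSize A
  m = reach A
  e+m : e + m ≡ n
  e+m = trans (min+max ∣ A ∣ (coSize A)) (size+coSize A)
    where
    min+max : ∀ a c → (a ⊓ c) + (a ⊔ c) ≡ a + c
    min+max a c with ≤-total a c
    ... | inj₁ a≤c = cong₂ _+_ (m≤n⇒m⊓n≡m a≤c) (m≤n⇒m⊔n≡n a≤c)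
    ... | inj₂ c≤a = trans (cong₂ _+_ (m≥n⇒m⊓n≡n c≤a) (m≥n⇒m⊔n≡m c≤a)) (+-comm c a)
  -- The sets `P ⊂ Q` have different sizes, both in `[e , m]`.
  e<m : e < m
  e<m = ≤-<-trans (proj₁ (reach≤⇒ e m e+m P (A-farthest P P∈)))
    (<-≤-trans (p⊂q⇒∣p∣<∣q∣ P⊂Q) (proj₂ (reach≤⇒ e m e+m Q (A-farthest Q Q∈))))
  m≤n : m ≤ n
  m≤n = subst (m ≤_) e+m (m≤n+m m e)
  e≤n : e ≤ n
  e≤n = subst (e ≤_) e+m (m≤m+n e m)
  between : ∀ f → Flag n f → Between n e m (trace 𝒜 f)
  between f F = record
    { inner = λ a e<a a<m → let sz = Flag-size F a (≤-trans (<⇒≤ a<m) m≤n) in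
        Centred.cond-i centred A (f a) A∈ (reach⇒closer (f a) A
          (⇒reach< e m e+m (f a) (subst (e <_) (sym sz) e<a) (subst (_< m) (sym sz) a<m)))
    ; outer = λ a a≤n a∈ → let p , q = reach≤⇒ e m e+m (f a) (A-farthest (f a) a∈) ; sz = Flag-size F a a≤n in
        subst (e ≤_) sz p , subst (_≤ m) sz q }
  finish : ∀ s → AllGood 𝒜 s e m → Profile 𝒜 r
  finish s good with flagSum-positive n _ (subst (0 <_) (sym (flagSum-chains 𝒜 (suc r))) (*-mono-< (1≤n! n) pos))
  ... | f , F , pos′ = record
    { s = s ; e = e ; m = m ; e+m = e+m ; e<m = e<m ; allGood = good
    ; multiplier-positive = multiplier>0 {r = r} {s} {e} {m} {trace 𝒜 f} e+m e<m (good f F) pos′ }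
  profile : Profile 𝒜 r
  -- The stage is read off from the kind of comparable pair that does not occur on levels `e` and
  -- `m`. If both kinds occurred, the pairs themselves would show both levels to be partly filled,
  -- against condition (ii).
  profile with pair? 𝒜 e m | pair? (complement 𝒜) e m
  ... | no none | _ = finish first (λ f F → record
        { between = between f F
        ; outermost-first = λ { _ (fe , fm) → none (f e , f m , Flag-size F e e≤n , Flag-size F m m≤n , fe , fm , Flag-⊂ F e m e<m m≤n) }
        ; outermost-second = λ () })
  ... | yes _ | no none = finish second (λ f F → record
        { between = between f F
        ; outermost-first = λ ()
        ; outermost-second = λ _ → either f F })
    where
    either : ∀ f → Flag n f → 𝒜 (f e) ≡ true ⊎ 𝒜 (f m) ≡ true
    either f F with 𝒜 (f e) in fe | 𝒜 (f m) in fm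
    ... | true  | _     = inj₁ refl
    ... | false | true  = inj₂ refl
    ... | false | false = contradiction (f e , f m , Flag-size F e e≤n , Flag-size F m m≤n ,
            cong not fe , cong not fm , Flag-⊂ F e m e<m m≤n) none
  ... | yes (B , C , Be , Cm , B∈ , C∈ , B⊂C) | yes (B′ , C′ , B′e , C′m , B′∉ , C′∉ , B′⊂C′) =
    [ (λ h → contradiction (B , C , Be , trans Cm m≡ , B∈ , C∈ , B⊂C) h)
    , (λ h → contradiction (B′ , C′ , B′e , trans C′m m≡ , not-true⁻¹ B′∉ , not-true⁻¹ C′∉ , B′⊂C′) h) ]′
    (Centred.cond-ii centred e 2e<n
      ((B , Be , B∈) , (B′ , B′e , not-true⁻¹ B′∉))
      ((C , trans Cm m≡ , C∈) , (C′ , trans C′m m≡ , not-true⁻¹ C′∉)))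
    where
    m≡ : m ≡ n ∸ e
    m≡ = sym (n∸e {s = first} e+m)
    2e<n : 2 * e < n
    2e<n = subst (2 * e <_) e+m (subst (λ t → e + t < e + m) (sym (+-identityʳ e)) (+-monoʳ-< e e<m))

-- Every set and every comparable pair lies on some maximal chain, so conditions on the traces
-- become conditions on the family.
AllGood⇒Centred : ∀ (𝒜 : Family n) s e m → e + m ≡ n → e < m → AllGood 𝒜 s e m → Centred 𝒜
AllGood⇒Centred {n} 𝒜 s e m e+m e<m good = record { cond-i = cond-i ; cond-ii = cond-ii }
  where
  levels : ∀ A → A ∈F 𝒜 → e ≤ ∣ A ∣ × ∣ A ∣ ≤ m
  levels A A∈ with f , F , fA ← flag-through-set A = Good.outer (good f F) ∣ A ∣ (∣p∣≤n A) (trans (cong 𝒜 fA) A∈)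
  core : ∀ A → e < ∣ A ∣ → ∣ A ∣ < m → A ∈F 𝒜
  core A p q with f , F , fA ← flag-through-set A = trans (sym (cong 𝒜 fA)) (Good.inner (good f F) ∣ A ∣ p q)
  cond-i : ∀ A B → A ∈F 𝒜 → closerToMiddle B A → B ∈F 𝒜
  cond-i A B A∈ closer = let p , q = levels A A∈ ; p′ , q′ = reach<⇒ e m e+m B
                               (<-≤-trans (closer⇒reach B A closer) (⇒reach≤ e m e+m A p q)) in core B p′ q′
  cond-ii : ∀ i → 2 * i < n → someButNotAll 𝒜 i → someButNotAll 𝒜 (n ∸ i) → _
  cond-ii i 2i<n ((A , refl , A∈) , (A′ , A′i , A′∉)) _ with levels A A∈
  ... | e≤i , i≤m with m≤n⇒m<n∨m≡n e≤i
  -- Levels strictly between `e` and `m` are full, so a partly filled level below the middle can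
  -- only be `e`.
  ...   | inj₁ e<i = contradiction (core A′ (subst (e <_) (sym A′i) e<i) (subst (_< m) (sym A′i) i<m)) A′∉
    where
    i<m : ∣ A ∣ < m
    i<m = ≤∧≢⇒< i≤m (λ i≡m → <⇒≱ 2i<n (≤-trans (≤-reflexive (sym e+m)) (≤-trans (+-monoˡ-≤ m (<⇒≤ e<m))
            (≤-reflexive (trans (cong (m +_) (sym (+-identityʳ m))) (cong (2 *_) (sym i≡m)))))))
  ...   | inj₂ e≡i = by-stage s refl
    where
    co : n ∸ ∣ A ∣ ≡ m
    co = trans (cong (n ∸_) (sym e≡i)) (n∸e {s = s} e+m)
    Pairs : Bool → Set
    Pairs v = ∃₂ λ B C → ∣ B ∣ ≡ ∣ A ∣ × ∣ C ∣ ≡ n ∸ ∣ A ∣ × 𝒜 B ≡ v × 𝒜 C ≡ v × B ⊂ C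
    on-flag : ∀ v → Pairs v → ∃ λ f → Flag n f × 𝒜 (f e) ≡ v × 𝒜 (f m) ≡ v
    on-flag v (B , C , Bi , Ci , Bv , Cv , B⊂C) with f , F , fB , fC ← flag-through-pair B C (p⊂q⇒p⊆q B⊂C) =
      f , F , trans (cong 𝒜 (trans (cong f (trans e≡i (sym Bi))) fB)) Bv ,
              trans (cong 𝒜 (trans (cong f (trans (sym co) (sym Ci))) fC)) Cv
    by-stage : ∀ t → s ≡ t → _ ⊎ _
    by-stage first eq = inj₁ (λ pairs → let f , F , fe , fm = on-flag true pairs in
      Good.outermost-first (good f F) eq (fe , fm))
    by-stage second eq = inj₂ λ { (B , C , Bi , Ci , B∉ , C∉ , B⊂C) →
      let f , F , fe , fm = on-flag false (B , C , Bi , Ci , ¬-not B∉ , ¬-not C∉ , B⊂C) in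
      [ (λ p → contradiction (trans (sym p) fe) (λ ())) , (λ p → contradiction (trans (sym p) fm) (λ ())) ]′
      (Good.outermost-second (good f F) eq) }

-- Comparison of two families of equal size

module Comparison (r : ℕ) (𝒜 ℬ : Family n) (sizes : size 𝒜 ≡ size ℬ) (profile : Profile 𝒜 r) where
  open Profile profile
  open Optimisation n r s e m e+m e<m multiplier-positive

  totalPrice : Family n → ℕ
  totalPrice 𝒞 = flagSum n (λ f → price (trace 𝒞 f))

  totalPrice-𝒜 : totalPrice 𝒜 ≡ flagSum n (λ _ → price (centre s))
  totalPrice-𝒜 = flagSum-cong n (λ f F → Good-price (allGood f F))

  totalPrice-𝒜≤ℬ : totalPrice 𝒜 ≤ totalPrice ℬ
  totalPrice-𝒜≤ℬ = ≤-trans (≤-reflexive totalPrice-𝒜) (flagSum-mono n (λ f _ → centre-minimal (trace ℬ f)))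

  -- With equal totals no maximal chain could exceed the minimal price, so every trace of `ℬ` would
  -- be good for the same `s`, `e`, `m`, and `ℬ` would be centred.
  totalPrice-𝒜<ℬ : ¬ Centred ℬ → totalPrice 𝒜 < totalPrice ℬ
  totalPrice-𝒜<ℬ not-centred = ≤∧≢⇒< totalPrice-𝒜≤ℬ (λ eq →
    not-centred (AllGood⇒Centred ℬ s e m e+m e<m (λ f F → minimal-Good (trace ℬ f) (≮⇒≥ (λ lt →
      <⇒≢ (flagSum-strict (λ f _ → centre-minimal (trace ℬ f)) F lt) (trans (sym totalPrice-𝒜) eq))))))

  totalPrice-common : ∀ 𝒞 → size 𝒞 ≡ size ℬ → totalPrice 𝒞 ≡ n ! * chains (2 + r) 𝒞 + D * (n ! * size (complement ℬ))
  totalPrice-common 𝒞 eq = trans (flagSum-cost 𝒞 (suc r) D)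
    (cong (λ t → n ! * chains (2 + r) 𝒞 + D * (n ! * t)) (size-complement 𝒞 ℬ eq))

  chains-≤ : chains (2 + r) 𝒜 ≤ chains (2 + r) ℬ
  chains-≤ = *-cancelˡ-≤ (n !) {{n !≢0}} (+-cancelʳ-≤ (D * (n ! * size (complement ℬ))) _ _
    (subst₂ _≤_ (totalPrice-common 𝒜 sizes) (totalPrice-common ℬ refl) totalPrice-𝒜≤ℬ))

  chains-< : ¬ Centred ℬ → chains (2 + r) 𝒜 < chains (2 + r) ℬ
  chains-< not-centred = *-cancelˡ-< (n !) _ _ (+-cancelʳ-< (D * (n ! * size (complement ℬ))) _ _
    (subst₂ _<_ (totalPrice-common 𝒜 sizes) (totalPrice-common ℬ refl) (totalPrice-𝒜<ℬ not-centred)))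

chains-minimal : ∀ k (𝒜 ℬ : Family n) → .{{_ : NonZero k}} → size 𝒜 ≡ size ℬ → Centred 𝒜 → chains k 𝒜 ≤ chains k ℬ
chains-minimal (suc zero) 𝒜 ℬ eq centred =
  ≤-reflexive (trans (chains-one 𝒜) (trans eq (sym (chains-one ℬ))))
chains-minimal (suc (suc r)) 𝒜 ℬ eq centred with chains (2 + r) 𝒜 in c
-- Without a chain in `𝒜` the bound is trivial; a chain is what guarantees a positive multiplier in
-- the other case.
... | zero  = z≤n
... | suc _ = subst (_≤ chains (2 + r) ℬ) c
  (Comparison.chains-≤ r 𝒜 ℬ eq (Centred⇒Profile 𝒜 r centred (subst (0 <_) (sym c) z<s)))

theorem1p1 : (n : ℕ) → .{{_ : NonZero n}} → (a k : ℕ) → .{{_ : NonZero a}} → .{{_ : NonZero k}} →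
    ((𝒜 : Family n) → size 𝒜 ≡ a → Centred 𝒜 →
    (ℬ : Family n) → size ℬ ≡ a → chains k 𝒜 ≤ chains k ℬ)
    ×
    (k ≥ 2 → (𝒜 : Family n) → size 𝒜 ≡ a → Centred 𝒜 → 1 ≤ chains k 𝒜 →
    (ℬ : Family n) → size ℬ ≡ a → ¬ Centred ℬ → chains k 𝒜 < chains k ℬ)
theorem1p1 n a k =
  (λ 𝒜 𝒜a centred ℬ ℬa → chains-minimal k 𝒜 ℬ (trans 𝒜a (sym ℬa)) centred) ,
  (λ { (s≤s (s≤s {n = r} z≤n)) 𝒜 𝒜a centred pos ℬ ℬa not-centred →
       Comparison.chains-< r 𝒜 ℬ (trans 𝒜a (sym ℬa)) (Centred⇒Profile 𝒜 r centred pos) not-centred })
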